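{- Let $k\ge 2$ be an integer. For $n\ge 1$ let \[E_{n,k}=\frac{1}{k^n}\sum_{i=1}^n i\cdot \mathrm{IB}_k(n,i),\] the expected width of the largest BP-factorization of a uniformly random length-$n$ word over $\Sigma_k$, where $\mathrm{IB}_k(n,i)$ is the number of length-$n$ words over $\Sigma_k$ whose largest BP-factorization has width $i$. Then the limit $E_k=\lim_{n\to\infty}E_{n,k}$ exists.
   Context: $\Sigma_k=\{0,1,\ldots,k-1\}$. A block palindrome factorization (BP-factorization) of a word $w$ is a factorization $w=w_m\cdots w_1w_0w_1\cdots w_m$ with $m\ge 0$, $w_0$ a possibly empty word and $w_1,\dots,w_m$ non-empty words. Its width is $2m+1$ if $w_0$ is non-empty and $2m$ if $w_0$ is empty. A largest BP-factorization of $w$ is a BP-factorization of $w$ of maximum width. -}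

module Defs where

open import Data.Nat.Base as ℕ using (ℕ; zero; suc; NonZero; z≤n; s≤s)
import Data.Nat.Properties as ℕ
open import Data.Nat.ListAction using (sum)
open import Data.Nat.Solver using (module +-*-Solver)
open import Data.Integer.Base as ℤ using (+_)
import Data.Integer.Solver as ℤSolver
open import Data.Rational.Base as ℚ using (ℚ; 0ℚ; _/_)
import Data.Rational.Properties as ℚ
import Data.Rational.Solver as ℚSolver
import Data.Rational.Unnormalised.Base as ℚᵘ
import Data.Rational.Unnormalised.Properties as ℚᵘ
open import Data.Fin.Base using (Fin)
import Data.Fin.Properties as Fin
open import Data.List.Base
  using (List; []; _∷_; _++_; map; concat; reverse; length; take; drop;
         filter; allFin; applyUpTo; cartesianProductWith)
open import Data.List.Properties
  using (≡-dec; ++-assoc; ++-identityʳ; map-++; concat-++; unfold-reverse;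
         length-++)
open import Data.List.NonEmpty.Base as List⁺ using (List⁺; toList)
open import Data.Product.Base using (∃; _×_; _,_)
open import Data.Sum.Base using (inj₁; inj₂)
open import Function.Base using (_∘_)
open import Relation.Binary.Definitions using (DecidableEquality)
open import Relation.Binary.PropositionalEquality
  using (_≡_; refl; sym; trans; cong; cong₂; subst; module ≡-Reasoning)
open import Relation.Nullary.Decidable using (Dec; no; map′; _×-dec_; _→-dec_)
open import Relation.Unary using (Decidable)

module _ {A : Set} where

  -- The blocks are listed from the outside in, [ w_m , … , w₁ ].
  unfoldBlocks : List (List⁺ A) → List A → List A
  unfoldBlocks blocks w₀ =
    concat (map toList blocks) ++ w₀ ++ concat (map toList (reverse blocks))

  record BPFactorization (w : List A) : Set where
    constructor bp
    field
      blocks   : List (List⁺ A)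
      center   : List A
      factors  : w ≡ unfoldBlocks blocks center

  widthOf : ℕ → List A → ℕ
  widthOf m []      = 2 ℕ.* m
  widthOf m (_ ∷ _) = 2 ℕ.* m ℕ.+ 1

  width : {w : List A} → BPFactorization w → ℕ
  width (bp blocks center _) = widthOf (length blocks) center

  IsLargest : {w : List A} → BPFactorization w → Set
  IsLargest {w} f = (g : BPFactorization w) → width g ℕ.≤ width f

  LargestWidth : List A → ℕ → Set
  LargestWidth w i = ∃ λ (f : BPFactorization w) → IsLargest f × width f ≡ i

  -- Everything up to largestWidth? serves only to make LargestWidth decidable,
  -- so that words satisfying it can be counted by filtering.

  unfoldBlocks-∷ : ∀ u us w₀ →
    unfoldBlocks (u ∷ us) w₀ ≡ toList u ++ unfoldBlocks us w₀ ++ toList u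
  unfoldBlocks-∷ u us w₀ = begin
    (U ++ X) ++ w₀ ++ concat (map toList (reverse (u ∷ us)))
      ≡⟨ cong (λ z → (U ++ X) ++ w₀ ++ z) rev ⟩
    (U ++ X) ++ w₀ ++ Y ++ U
      ≡⟨ ++-assoc U X _ ⟩
    U ++ X ++ w₀ ++ Y ++ U
      ≡⟨ cong (λ z → U ++ X ++ z) (++-assoc w₀ Y U) ⟨
    U ++ X ++ (w₀ ++ Y) ++ U
      ≡⟨ cong (U ++_) (++-assoc X (w₀ ++ Y) U) ⟨
    U ++ (X ++ w₀ ++ Y) ++ U
      ∎
    where
    open ≡-Reasoning
    U X Y : List A
    U = toList u
    X = concat (map toList us)
    Y = concat (map toList (reverse us))
    rev : concat (map toList (reverse (u ∷ us))) ≡ Y ++ U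
    rev = begin
      concat (map toList (reverse (u ∷ us)))
        ≡⟨ cong (concat ∘ map toList) (unfold-reverse u us) ⟩
      concat (map toList (reverse us ++ u ∷ []))
        ≡⟨ cong concat (map-++ toList (reverse us) (u ∷ [])) ⟩
      concat (map toList (reverse us) ++ U ∷ [])
        ≡⟨ concat-++ (map toList (reverse us)) (U ∷ []) ⟨
      Y ++ (U ++ [])
        ≡⟨ cong (Y ++_) (++-identityʳ U) ⟩
      Y ++ U
        ∎

  widthOf-suc : ∀ m w₀ → widthOf (suc m) w₀ ≡ 2 ℕ.+ widthOf m w₀
  widthOf-suc m []      = solve 1 (λ m → con 2 :* (con 1 :+ m) := con 2 :+ con 2 :* m) refl m
    where open +-*-Solver
  widthOf-suc m (_ ∷ _) =
    solve 1 (λ m → con 2 :* (con 1 :+ m) :+ con 1 := con 2 :+ (con 2 :* m :+ con 1)) refl m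
    where open +-*-Solver

  widthOf≤length : ∀ us w₀ → widthOf (length us) w₀ ℕ.≤ length (unfoldBlocks us w₀)
  widthOf≤length []       []      = z≤n
  widthOf≤length []       (_ ∷ _) = s≤s z≤n
  widthOf≤length (u ∷ us) w₀      = begin
    widthOf (suc (length us)) w₀        ≡⟨ widthOf-suc (length us) w₀ ⟩
    2 ℕ.+ widthOf (length us) w₀        ≤⟨ ℕ.+-monoʳ-≤ 2 (widthOf≤length us w₀) ⟩
    2 ℕ.+ length V                      ≡⟨ cong suc (ℕ.+-comm 1 (length V)) ⟩
    1 ℕ.+ (length V ℕ.+ 1)              ≤⟨ ℕ.+-mono-≤ 1≤ (ℕ.+-monoʳ-≤ (length V) 1≤) ⟩
    length U ℕ.+ (length V ℕ.+ length U) ≡⟨ cong (length U ℕ.+_) (length-++ V) ⟨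
    length U ℕ.+ length (V ++ U)        ≡⟨ length-++ U ⟨
    length (U ++ V ++ U)                ≡⟨ cong length (unfoldBlocks-∷ u us w₀) ⟨
    length (unfoldBlocks (u ∷ us) w₀)   ∎
    where
    open ℕ.≤-Reasoning
    U V : List A
    U = toList u
    V = unfoldBlocks us w₀
    1≤ : 1 ℕ.≤ length U
    1≤ = s≤s z≤n

  width≤length : ∀ {w} (f : BPFactorization w) → width f ℕ.≤ length w
  width≤length (bp us w₀ refl) = widthOf≤length us w₀

  m≤widthOf : ∀ m w₀ → m ℕ.≤ widthOf m w₀
  m≤widthOf m []      = ℕ.m≤m+n m _
  m≤widthOf m (_ ∷ _) = ℕ.≤-trans (ℕ.m≤m+n m _) (ℕ.m≤m+n (2 ℕ.* m) 1)

  take-length-++ : ∀ (xs ys : List A) → take (length xs) (xs ++ ys) ≡ xs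
  take-length-++ []       ys = refl
  take-length-++ (x ∷ xs) ys = cong (x ∷_) (take-length-++ xs ys)

  drop-length-++ : ∀ (xs ys : List A) → drop (length xs) (xs ++ ys) ≡ ys
  drop-length-++ []       ys = refl
  drop-length-++ (x ∷ xs) ys = drop-length-++ xs ys

  module _ (_≟_ : DecidableEquality A) where

    Bordered : (List A → Set) → List A → Set
    Bordered Q w = ∃ λ (u : List⁺ A) → ∃ λ v → w ≡ toList u ++ v ++ toList u × Q v

    bordered? : ∀ {Q} → Decidable Q → Decidable (Bordered Q)
    bordered? Q? []           = no λ { (_ List⁺.∷ _ , _ , () , _) }
    bordered? {Q} Q? w@(a ∷ w′) =
      map′ sound complete
        (ℕ.anyUpTo? (λ i → ℕ.anyUpTo? (λ j →
          ≡-dec _≟_ w (toList (U i) ++ V i j ++ toList (U i)) ×-dec Q? (V i j)) bound) bound)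
      where
      bound : ℕ
      bound = suc (length w′)
      U : ℕ → List⁺ A
      U i = a List⁺.∷ take i w′
      V : ℕ → ℕ → List A
      V i j = take j (drop i w′)
      Found : Set
      Found = ∃ λ i → i ℕ.< bound × ∃ λ j → j ℕ.< bound ×
        (w ≡ toList (U i) ++ V i j ++ toList (U i)) × Q (V i j)
      sound : Found → Bordered Q w
      sound (i , _ , j , _ , eq , q) = U i , V i j , eq , q
      complete : Bordered Q w → Found
      complete (_ List⁺.∷ u , v , refl , q) =
        length u , s≤s (subst (length u ℕ.≤_) (sym (length-++ u)) (ℕ.m≤m+n _ _)) ,
        length v , s≤s v≤ ,
        cong₂ (λ x y → (a ∷ x) ++ y ++ (a ∷ x)) (sym Ueq) (sym Veq) , subst Q (sym Veq) q
        where
        Ueq : take (length u) (u ++ v ++ a ∷ u) ≡ u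
        Ueq = take-length-++ u _
        Veq : V (length u) (length v) ≡ v
        Veq = trans (cong (take (length v)) (drop-length-++ u _)) (take-length-++ v _)
        v≤ : length v ℕ.≤ length (u ++ v ++ a ∷ u)
        v≤ = subst (length v ℕ.≤_) (sym (trans (length-++ u) (cong (length u ℕ.+_) (length-++ v))))
          (ℕ.≤-trans (ℕ.m≤m+n _ _) (ℕ.m≤n+m _ (length u)))

    HasBlocks : ℕ → (List A → Set) → List A → Set
    HasBlocks m P w = ∃ λ us → ∃ λ w₀ → length us ≡ m × w ≡ unfoldBlocks us w₀ × P w₀

    hasBlocks? : ∀ m {P} → Decidable P → Decidable (HasBlocks m P)
    hasBlocks? zero {P} P? w = map′
      (λ p → [] , w , refl , sym (++-identityʳ w) , p)
      (λ { ([] , w₀ , _ , eq , p) → subst P (sym (trans eq (++-identityʳ w₀))) p })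
      (P? w)
    hasBlocks? (suc m) {P} P? w = map′
      (λ { (u , _ , eq , us , w₀ , refl , refl , p) →
           u ∷ us , w₀ , refl , trans eq (sym (unfoldBlocks-∷ u us w₀)) , p })
      (λ { (u ∷ us , w₀ , refl , eq , p) →
           u , unfoldBlocks us w₀ , trans eq (unfoldBlocks-∷ u us w₀) , us , w₀ , refl , refl , p })
      (bordered? (hasBlocks? m P?) w)

    hasWidth? : ∀ w i → Dec (∃ λ (f : BPFactorization w) → width f ≡ i)
    hasWidth? w i = map′
      (λ { (_ , _ , us , w₀ , refl , eq , p) → bp us w₀ eq , p })
      (λ { (bp us w₀ eq , refl) →
           length us , s≤s (m≤widthOf (length us) w₀) , us , w₀ , refl , eq , refl })
      (ℕ.anyUpTo? (λ m → hasBlocks? m (λ w₀ → widthOf m w₀ ℕ.≟ i) w) (suc i))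

    largestWidth? : ∀ i → Decidable (λ w → LargestWidth w i)
    largestWidth? i w = map′
      (λ { ((f , refl) , all) → f , (λ g → all (s≤s (width≤length g)) (g , refl)) , refl })
      (λ { (f , largest , refl) → (f , refl) , λ { _ (g , refl) → largest g } })
      (hasWidth? w i ×-dec
       ℕ.allUpTo? (λ j → hasWidth? w j →-dec (j ℕ.≤? i)) (suc (length w)))

words : (k n : ℕ) → List (List (Fin k))
words k zero    = [] ∷ []
words k (suc n) = cartesianProductWith _∷_ (allFin k) (words k n)

IB : (k n i : ℕ) → ℕ
IB k n i = length (filter (largestWidth? Fin._≟_ i) (words k n))

-- Also defined at n = 0, where the sum is empty; this does not affect the limit.
E : (k : ℕ) .{{_ : NonZero k}} → ℕ → ℚ
E k n = (+ sum (map (λ i → i ℕ.* IB k n i) (applyUpTo suc n))) / (k ℕ.^ n)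
  where instance _ = ℕ.m^n≢0 k n

1/1+ : ℕ → ℚ
1/1+ n = + 1 / suc n

-- Bishop's regular sequences with indices starting at 0: seq n is within
-- 1/(n+1) of the real. The setoid equality on ℝ is not needed here.
record ℝ : Set where
  constructor mkℝ
  field
    seq     : ℕ → ℚ
    regular : ∀ m n → ℚ.∣ seq m ℚ.- seq n ∣ ℚ.≤ 1/1+ m ℚ.+ 1/1+ n

open ℝ public

0≤1/1+ : ∀ n → 0ℚ ℚ.≤ 1/1+ n
0≤1/1+ n = ℚ.nonNegative⁻¹ (1/1+ n) {{ℚ.normalize-nonNeg 1 (suc n)}}

fromℚ : ℚ → ℝ
fromℚ q = mkℝ (λ _ → q) λ m n → begin
  ℚ.∣ q ℚ.- q ∣       ≡⟨ cong ℚ.∣_∣ (ℚ.+-inverseʳ q) ⟩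
  0ℚ                  ≤⟨ ℚ.+-mono-≤ (0≤1/1+ m) (0≤1/1+ n) ⟩
  1/1+ m ℚ.+ 1/1+ n   ∎
  where open ℚ.≤-Reasoning

double : ℕ → ℕ
double m = m ℕ.+ suc m

halves : ∀ m → 1/1+ (double m) ℚ.+ 1/1+ (double m) ≡ 1/1+ m
halves m = ℚ.toℚᵘ-injective (begin
  ℚ.toℚᵘ (1/1+ d ℚ.+ 1/1+ d)             ≈⟨ ℚ.toℚᵘ-homo-+ (1/1+ d) (1/1+ d) ⟩
  ℚ.toℚᵘ (1/1+ d) ℚᵘ.+ ℚ.toℚᵘ (1/1+ d)   ≈⟨ ℚᵘ.+-cong (un d) (un d) ⟩
  ℚᵘ.mkℚᵘ (+ 1) d ℚᵘ.+ ℚᵘ.mkℚᵘ (+ 1) d   ≈⟨ ℚᵘ.*≡* eq ⟩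
  ℚᵘ.mkℚᵘ (+ 1) m                        ≈⟨ un m ⟨
  ℚ.toℚᵘ (1/1+ m)                        ∎)
  where
  open import Relation.Binary.Reasoning.Setoid ℚᵘ.≃-setoid
  d : ℕ
  d = double m
  un : ∀ n → ℚ.toℚᵘ (1/1+ n) ℚᵘ.≃ ℚᵘ.mkℚᵘ (+ 1) n
  un n = ℚ.toℚᵘ-fromℚᵘ (ℚᵘ.mkℚᵘ (+ 1) n)
  eq : (+ 1 ℤ.* (+ suc d) ℤ.+ + 1 ℤ.* (+ suc d)) ℤ.* (+ suc m) ≡ + 1 ℤ.* (+ suc d ℤ.* + suc d)
  eq = solve 1 (λ x →
         (con (+ 1) :* (x :+ x) :+ con (+ 1) :* (x :+ x)) :* x
         := con (+ 1) :* ((x :+ x) :* (x :+ x))) refl (+ suc m)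
    where open ℤSolver.+-*-Solver

infixl 6 _-_

-- The index 2n+1 restores regularity, since the errors of x and y add.
_-_ : ℝ → ℝ → ℝ
x - y = mkℝ (λ n → seq x (double n) ℚ.- seq y (double n)) λ m n →
  let a = double m ; b = double n in begin
  ℚ.∣ (seq x a ℚ.- seq y a) ℚ.- (seq x b ℚ.- seq y b) ∣
    ≡⟨ cong ℚ.∣_∣ (swap (seq x a) (seq y a) (seq x b) (seq y b)) ⟩
  ℚ.∣ (seq x a ℚ.- seq x b) ℚ.- (seq y a ℚ.- seq y b) ∣
    ≤⟨ ℚ.∣p-q∣≤∣p∣+∣q∣ (seq x a ℚ.- seq x b) (seq y a ℚ.- seq y b) ⟩
  ℚ.∣ seq x a ℚ.- seq x b ∣ ℚ.+ ℚ.∣ seq y a ℚ.- seq y b ∣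
    ≤⟨ ℚ.+-mono-≤ (regular x a b) (regular y a b) ⟩
  (1/1+ a ℚ.+ 1/1+ b) ℚ.+ (1/1+ a ℚ.+ 1/1+ b)
    ≡⟨ pair (1/1+ a) (1/1+ b) ⟩
  (1/1+ a ℚ.+ 1/1+ a) ℚ.+ (1/1+ b ℚ.+ 1/1+ b)
    ≡⟨ cong₂ ℚ._+_ (halves m) (halves n) ⟩
  1/1+ m ℚ.+ 1/1+ n
    ∎
  where
  open ℚ.≤-Reasoning
  open ℚSolver.+-*-Solver
  swap : ∀ p q r s → (p ℚ.- q) ℚ.- (r ℚ.- s) ≡ (p ℚ.- r) ℚ.- (q ℚ.- s)
  swap = solve 4 (λ p q r s → (p :- q) :- (r :- s) := (p :- r) :- (q :- s)) refl
  pair : ∀ p q → (p ℚ.+ q) ℚ.+ (p ℚ.+ q) ≡ (p ℚ.+ p) ℚ.+ (q ℚ.+ q)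
  pair = solve 2 (λ p q → (p :+ q) :+ (p :+ q) := (p :+ p) :+ (q :+ q)) refl

∣p∣-∣q∣≤∣p-q∣ : ∀ p q → ℚ.∣ p ∣ ℚ.- ℚ.∣ q ∣ ℚ.≤ ℚ.∣ p ℚ.- q ∣
∣p∣-∣q∣≤∣p-q∣ p q = begin
  ℚ.∣ p ∣ ℚ.- ℚ.∣ q ∣                       ≡⟨ cong (λ r → ℚ.∣ r ∣ ℚ.- ℚ.∣ q ∣) (split p q) ⟩
  ℚ.∣ (p ℚ.- q) ℚ.+ q ∣ ℚ.- ℚ.∣ q ∣         ≤⟨ ℚ.+-monoˡ-≤ (ℚ.- ℚ.∣ q ∣) (ℚ.∣p+q∣≤∣p∣+∣q∣ (p ℚ.- q) q) ⟩
  (ℚ.∣ p ℚ.- q ∣ ℚ.+ ℚ.∣ q ∣) ℚ.- ℚ.∣ q ∣   ≡⟨ cancel ℚ.∣ p ℚ.- q ∣ ℚ.∣ q ∣ ⟩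
  ℚ.∣ p ℚ.- q ∣                             ∎
  where
  open ℚ.≤-Reasoning
  open ℚSolver.+-*-Solver
  split : ∀ p q → p ≡ (p ℚ.- q) ℚ.+ q
  split = solve 2 (λ p q → p := (p :- q) :+ q) refl
  cancel : ∀ p q → (p ℚ.+ q) ℚ.- q ≡ p
  cancel = solve 2 (λ p q → (p :+ q) :- q := p) refl

neg-minus : ∀ p q → ℚ.- (p ℚ.- q) ≡ q ℚ.- p
neg-minus = solve 2 (λ p q → :- (p :- q) := q :- p) refl
  where open ℚSolver.+-*-Solver

∣∣p∣-∣q∣∣≤∣p-q∣ : ∀ p q → ℚ.∣ ℚ.∣ p ∣ ℚ.- ℚ.∣ q ∣ ∣ ℚ.≤ ℚ.∣ p ℚ.- q ∣
∣∣p∣-∣q∣∣≤∣p-q∣ p q with ℚ.∣p∣≡p∨∣p∣≡-p (ℚ.∣ p ∣ ℚ.- ℚ.∣ q ∣)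
... | inj₁ eq = subst (ℚ._≤ ℚ.∣ p ℚ.- q ∣) (sym eq) (∣p∣-∣q∣≤∣p-q∣ p q)
... | inj₂ eq = begin
  ℚ.∣ ℚ.∣ p ∣ ℚ.- ℚ.∣ q ∣ ∣   ≡⟨ eq ⟩
  ℚ.- (ℚ.∣ p ∣ ℚ.- ℚ.∣ q ∣)   ≡⟨ neg-minus ℚ.∣ p ∣ ℚ.∣ q ∣ ⟩
  ℚ.∣ q ∣ ℚ.- ℚ.∣ p ∣         ≤⟨ ∣p∣-∣q∣≤∣p-q∣ q p ⟩
  ℚ.∣ q ℚ.- p ∣               ≡⟨ cong ℚ.∣_∣ (neg-minus p q) ⟨
  ℚ.∣ ℚ.- (p ℚ.- q) ∣         ≡⟨ ℚ.∣-p∣≡∣p∣ (p ℚ.- q) ⟩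
  ℚ.∣ p ℚ.- q ∣               ∎
  where open ℚ.≤-Reasoning

∣_∣ : ℝ → ℝ
∣ x ∣ = mkℝ (λ n → ℚ.∣ seq x n ∣) λ m n →
  ℚ.≤-trans (∣∣p∣-∣q∣∣≤∣p-q∣ (seq x m) (seq x n)) (regular x m n)

infix 4 _≤_

-- The slack 2/(n+1) absorbs the errors of x and y at index n.
_≤_ : ℝ → ℝ → Set
x ≤ y = ∀ n → seq x n ℚ.≤ seq y n ℚ.+ (1/1+ n ℚ.+ 1/1+ n)

_ConvergesTo_ : (ℕ → ℝ) → ℝ → Set
a ConvergesTo x = ∀ (ε : ℚ) → 0ℚ ℚ.< ε →
  ∃ λ N → ∀ n → N ℕ.≤ n → ∣ a n - x ∣ ≤ fromℚ ε

HasLimit : (ℕ → ℝ) → Set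
HasLimit a = ∃ λ x → a ConvergesTo x

{-# OPTIONS --safe #-}

-- Reading a word from the center outwards as a word z of pairs (w_i , w_{n+1-i}), the block pairs of
-- a BP-factorization become blocks that are palindromes up to swapping the entries of each pair.
-- If x and y ++ x are both concatenations of such palindromes then so is y; hence the
-- number m of block pairs of a largest BP-factorization is the number of nonempty suffixes of z that
-- are such concatenations. With A h counting these concatenations among the words of h pairs this gives
--   E (2h+1) = 1 + 2 Σ_{1≤l≤h} A l / k^(2l)   and   E (2h) = E (2h+1) - A h / k^(2h).
-- Splitting off a shortest first block bounds A h / k^(2h) by (7/8)^h, so E is a Cauchy sequence.
module Submission where

open import Defs
  using (unfoldBlocks; unfoldBlocks-∷; BPFactorization; bp; width; widthOf; LargestWidth;
         HasBlocks; hasBlocks?; width≤length; largestWidth?; words; IB; E;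
         1/1+; 0≤1/1+; mkℝ; fromℚ; HasLimit; neg-minus; double)
open import Data.Nat.Base as ℕ
  using (ℕ; zero; suc; _+_; _*_; _∸_; _^_; _≤_; _<_; z≤n; s≤s; z<s; ⌊_/2⌋; NonZero; >-nonZero)
open import Data.Nat.Properties as ℕ using (<-trans)
open import Data.Nat.ListAction using (sum)
open import Data.Nat.ListAction.Properties using (sum-++)
open import Data.Nat.Solver using (module +-*-Solver)
open import Data.Integer.Base as ℤ using () renaming (+_ to pos)
import Data.Integer.Properties as ℤ
open import Data.Rational.Base as ℚ using (ℚ; mkℚ; 0ℚ; 1ℚ; _/_; ↧ₙ_)
import Data.Rational.Properties as ℚ
import Data.Rational.Solver as ℚSolver
import Data.Rational.Unnormalised.Base as ℚᵘ
import Data.Rational.Unnormalised.Properties as ℚᵘ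
open import Data.Bool.Base using (true; false; if_then_else_)
open import Data.Empty using (⊥-elim)
open import Data.Fin.Base using (Fin; punchIn; punchOut)
import Data.Fin.Properties as Fin
open import Data.List.Base
  using (List; []; _∷_; _∷ʳ_; _++_; map; reverse; _ʳ++_; length; zip; concatMap;
         initLast; _∷ʳ′_; filter; allFin; applyUpTo; cartesianProduct; cartesianProductWith)
open import Data.List.Properties hiding (sum-++)
open import Data.List.NonEmpty.Base as List⁺ using (List⁺; toList)
open import Data.List.Membership.Propositional using (_∈_; lose)
open import Data.List.Membership.Propositional.Properties
  using (∈-map⁺; ∈-++⁺ˡ; ∈-++⁺ʳ; ∈-concatMap⁺; ∈-allFin; ∈-cartesianProduct⁺)
open import Data.List.Relation.Unary.Any using (here; there)
open import Data.List.Relation.Unary.All using (All; []; _∷_)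
open import Data.List.Relation.Unary.AllPairs using ([]; _∷_)
open import Data.List.Relation.Unary.Unique.Propositional using (Unique)
open import Data.List.Relation.Unary.Unique.Propositional.Properties using (allFin⁺; cartesianProduct⁺)
open import Data.Product.Base using (∃; _×_; _,_; proj₁; proj₂; swap)
import Data.Product.Properties as Product
open import Data.Sum.Base using (_⊎_; inj₁; inj₂; [_,_]′)
open import Function.Base using (_∘_; case_of_)
open import Relation.Binary.Definitions using (DecidableEquality)
open import Relation.Binary.PropositionalEquality
  using (_≡_; _≢_; refl; sym; trans; cong; cong₂; subst; subst₂; module ≡-Reasoning)
open import Relation.Nullary using (Dec; yes; no; ¬_; does; contradiction)
open import Relation.Nullary.Decidable using (map′)
open import Relation.Unary using (Decidable)

-- Palindromes of pairs

-- The cancellation property and its mirror image say that the concatenations form a free monoid on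
-- a bifix code. So the starts of all suffixes in this monoid are the finest possible cut points.
-- What precedes the longest such suffix becomes the center. For even length the center is empty
-- exactly when the whole word is a concatenation, which explains the correction by `A h`.
--
-- The decay is delicate at k = 2. There are k^m palindromes of m pairs, so their densities k^m /
-- k^(2m) add up to 1/(k-1), which is 1 for k = 2, and splitting off an arbitrary first palindrome
-- proves nothing. A shortest first block is a single pair (a , a) or starts with unequal entries.
-- Even if any palindrome is allowed as its inner part, such blocks have total density 1/k + 1/k^2,
-- at most 3/4. The resulting recursion grows like k + sqrt(k(k-1)). Relative to k^2 this is largest
-- at k = 2, where it is about 0.854, just below 7/8.

-- Levi's lemma, the source of the case distinctions on overlapping palindromes.
++-split : ∀ {A : Set} (xs {ys} zs {ws} : List A) → xs ++ ys ≡ zs ++ ws →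
  (∃ λ r → zs ≡ xs ++ r × ys ≡ r ++ ws) ⊎ (∃ λ r → xs ≡ zs ++ r × ws ≡ r ++ ys)
++-split []       zs       eq = inj₁ (zs , refl , eq)
++-split (x ∷ xs) []       eq = inj₂ (x ∷ xs , refl , sym eq)
++-split (x ∷ xs) (z ∷ zs) eq with ∷-injective eq
... | refl , eq′ with ++-split xs zs eq′
...   | inj₁ (r , refl , p) = inj₁ (r , refl , p)
...   | inj₂ (r , refl , p) = inj₂ (r , refl , p)

module _ {A : Set} where

  mirror : List (A × A) → List (A × A)
  mirror = reverse ∘ map swap

  mirror-++ : ∀ x y → mirror (x ++ y) ≡ mirror y ++ mirror x
  mirror-++ x y = trans (cong reverse (map-++ swap x y)) (reverse-++ (map swap x) (map swap y))

  mirror-involutive : ∀ x → mirror (mirror x) ≡ x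
  mirror-involutive x = begin
    reverse (map swap (reverse (map swap x)))  ≡⟨ cong reverse (reverse-map swap (map swap x)) ⟩
    reverse (reverse (map swap (map swap x)))  ≡⟨ reverse-involutive _ ⟩
    map swap (map swap x)                      ≡⟨ map-∘ x ⟨
    map (swap ∘ swap) x                        ≡⟨ map-id x ⟩
    x                                          ∎
    where open ≡-Reasoning

  Palindrome : List (A × A) → Set
  Palindrome x = mirror x ≡ x

  data Factorization : ℕ → List (A × A) → Set where
    []  : Factorization 0 []
    _∷_ : ∀ {e q m x} → Palindrome (e ∷ q) → Factorization m x →
          Factorization (suc m) ((e ∷ q) ++ x)

  Star : List (A × A) → Set
  Star x = ∃ λ m → Factorization m x

  palindrome⇒star : ∀ {x} → Palindrome x → Star x
  palindrome⇒star {[]}    _ = 0 , []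
  palindrome⇒star {e ∷ q} p = 1 , subst (Factorization 1) (++-identityʳ (e ∷ q)) (p ∷ [])

  Factorization-++ : ∀ {m n x y} → Factorization m x → Factorization n y → Factorization (m + n) (x ++ y)
  Factorization-++ [] g = g
  Factorization-++ {n = n} {y = y} (_∷_ {e} {q} {m} {x} p f) g =
    subst (Factorization _) (sym (++-assoc (e ∷ q) x y)) (p ∷ Factorization-++ f g)

  star-++ : ∀ {x y} → Star x → Star y → Star (x ++ y)
  star-++ (_ , f) (_ , g) = _ , Factorization-++ f g

  star-mirror : ∀ {x} → Star x → Star (mirror x)
  star-mirror (_ , f₀) = go f₀
    where
    go : ∀ {m x} → Factorization m x → Star (mirror x)
    go [] = 0 , []
    go (_∷_ {e} {q} {x = x} p f) =
      subst Star (sym (trans (mirror-++ (e ∷ q) x) (cong (mirror x ++_) p)))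
        (star-++ (go f) (palindrome⇒star p))

  -- The overlapping case is Euclid's algorithm on the lengths of q and t.
  palindrome-quotient : ∀ n q t → length q ≤ n →
    Palindrome q → Palindrome (q ++ t) → Star t
  palindrome-quotient n q [] _ _ _ = 0 , []
  palindrome-quotient n q t@(_ ∷ _) q≤n pq pqt
    -- Mirroring the palindrome `q ++ t` gives `q ++ t ≡ mirror t ++ q`. Either way the overlap `r`
    -- of the two sides is again a palindrome.
    with ++-split q (mirror t) (trans (sym pqt) (trans (mirror-++ q t) (cong (mirror t ++_) pq)))
  ... | inj₁ (r , mt≡ , t≡) = subst Star (sym t≡) (star-++ (palindrome⇒star pr) (palindrome⇒star pq))
    where
    pr : Palindrome r
    pr = ++-cancelˡ q (mirror r) r (begin
      q ++ mirror r         ≡⟨ cong (_++ mirror r) pq ⟨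
      mirror q ++ mirror r  ≡⟨ mirror-++ r q ⟨
      mirror (r ++ q)       ≡⟨ cong mirror t≡ ⟨
      mirror t              ≡⟨ mt≡ ⟩
      q ++ r                ∎)
      where open ≡-Reasoning
  palindrome-quotient zero    q t@(_ ∷ _) q≤0 _ _ | inj₂ (r , q≡ , q≡′) = ⊥-elim (impossible q≤0 q≡′)
    where
    impossible : ∀ {q r} → length q ≤ 0 → q ≢ r ++ t
    impossible {r = []}    () refl
    impossible {r = _ ∷ _} () refl
  palindrome-quotient (suc n) q t@(_ ∷ _) q≤n pq pqt | inj₂ (r , q≡ , q≡′) =
    palindrome-quotient n r t r≤n pr (subst Palindrome q≡′ pq)
    where
    pr : Palindrome r
    pr = ++-cancelˡ (mirror t) (mirror r) r (begin
      mirror t ++ mirror r  ≡⟨ mirror-++ r t ⟨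
      mirror (r ++ t)       ≡⟨ cong mirror q≡′ ⟨
      mirror q              ≡⟨ pq ⟩
      q                     ≡⟨ q≡ ⟩
      mirror t ++ r         ∎)
      where open ≡-Reasoning
    r≤n : length r ≤ n
    r≤n = ℕ.s≤s⁻¹ (begin
      suc (length r)       ≤⟨ ℕ.m<m+n (length r) (s≤s z≤n) ⟩
      length r + length t  ≡⟨ length-++ r ⟨
      length (r ++ t)      ≡⟨ cong length q≡′ ⟨
      length q             ≤⟨ q≤n ⟩
      suc n                ∎)
      where open ℕ.≤-Reasoning

  length-suffix-≤ : ∀ {e : A × A} q x {n} → length ((e ∷ q) ++ x) ≤ suc n → length x ≤ n
  length-suffix-≤ q x le = ℕ.≤-trans (subst (length x ≤_) (sym (length-++ q)) (ℕ.m≤n+m _ _)) (ℕ.s≤s⁻¹ le)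

  -- Compare the first blocks of `x` and `w`. The shorter is a prefix of the longer, and by
  -- `palindrome-quotient` the rest `t` of the longer is a concatenation. After cancelling the
  -- shorter block, `t` joins the tail that follows it, and `w` has become shorter.
  star-quotient′ : ∀ n {m m′ x y w} → length w ≤ n →
    Factorization m x → Factorization m′ w → w ≡ x ++ y → Star y
  star-quotient′ n _ [] g refl = _ , g
  star-quotient′ n _ (_ ∷ _) [] ()
  star-quotient′ zero () _ (_ ∷ _) _
  star-quotient′ (suc n) {y = y} w≤ (_∷_ {e} {q} {x = x} p f) (_∷_ {e′} {q′} {x = x′} p′ g) eq
    with ++-split (e ∷ q) (e′ ∷ q′) (trans (sym (++-assoc (e ∷ q) x y)) (sym eq))
  ... | inj₁ (t , q′≡ , xy≡) = star-quotient′ n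
          (subst (λ l → length l ≤ n) xy≡
            (length-suffix-≤ {e = e} q (x ++ y) (subst (λ l → length l ≤ suc n) (trans eq (++-assoc (e ∷ q) x y)) w≤)))
          f (proj₂ (star-++ (palindrome-quotient _ _ t ℕ.≤-refl p (subst Palindrome q′≡ p′)) (_ , g)))
          (sym xy≡)
  ... | inj₂ (t , q≡ , x′≡) = star-quotient′ n (length-suffix-≤ {e = e′} q′ x′ w≤)
          (proj₂ (star-++ (palindrome-quotient _ _ t ℕ.≤-refl p′ (subst Palindrome q≡ p)) (_ , f)))
          g (trans x′≡ (sym (++-assoc t x y)))

  star-quotientˡ : ∀ {x y} → Star x → Star (x ++ y) → Star y
  star-quotientˡ (_ , f) (_ , g) = star-quotient′ _ ℕ.≤-refl f g refl

  -- Mirroring preserves concatenations of palindromes and exchanges prefixes with suffixes.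
  star-quotientʳ : ∀ {x y} → Star y → Star (x ++ y) → Star x
  star-quotientʳ {x} {y} sy sxy = subst Star (mirror-involutive x) (star-mirror
    (star-quotientˡ (star-mirror sy) (subst Star (mirror-++ x y) (star-mirror sxy))))

  -- Pair words are read from the center outwards.
  wrap : List (A × A) → List A → List A
  wrap []            c = c
  wrap ((a , b) ∷ z) c = wrap z (a ∷ c ∷ʳ b)

  wrap-++ : ∀ x y c → wrap (x ++ y) c ≡ wrap y (wrap x c)
  wrap-++ []      y c = refl
  wrap-++ (_ ∷ x) y c = wrap-++ x y _

  wrap≡ : ∀ z c → wrap z c ≡ reverse (map proj₁ z) ++ c ++ map proj₂ z
  wrap≡ []            c = sym (++-identityʳ c)
  wrap≡ ((a , b) ∷ z) c = begin
    wrap z (a ∷ c ∷ʳ b)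
      ≡⟨ wrap≡ z _ ⟩
    reverse (map proj₁ z) ++ a ∷ (c ∷ʳ b) ++ map proj₂ z
      ≡⟨ cong (λ l → reverse (map proj₁ z) ++ a ∷ l) (++-assoc c (b ∷ []) _) ⟩
    reverse (map proj₁ z) ++ a ∷ c ++ b ∷ map proj₂ z
      ≡⟨ ++-assoc (reverse (map proj₁ z)) (a ∷ []) _ ⟨
    (reverse (map proj₁ z) ∷ʳ a) ++ c ++ b ∷ map proj₂ z
      ≡⟨ cong (_++ (c ++ b ∷ map proj₂ z)) (unfold-reverse a (map proj₁ z)) ⟨
    reverse (a ∷ map proj₁ z) ++ c ++ b ∷ map proj₂ z
      ∎
    where open ≡-Reasoning

  length-wrap : ∀ z c → length (wrap z c) ≡ length z + (length z + length c)
  length-wrap z c = begin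
    length (wrap z c)
      ≡⟨ cong length (wrap≡ z c) ⟩
    length (reverse (map proj₁ z) ++ c ++ map proj₂ z)
      ≡⟨ length-++ (reverse (map proj₁ z)) ⟩
    length (reverse (map proj₁ z)) + length (c ++ map proj₂ z)
      ≡⟨ cong₂ _+_ (trans (length-reverse (map proj₁ z)) (length-map proj₁ z)) (length-++ c) ⟩
    length z + (length c + length (map proj₂ z))
      ≡⟨ cong (λ l → length z + (length c + l)) (length-map proj₂ z) ⟩
    length z + (length c + length z)
      ≡⟨ cong (length z +_) (ℕ.+-comm (length c) (length z)) ⟩
    length z + (length z + length c) ∎
    where open ≡-Reasoning

  -- The pair word of a block `u` standing on both sides of a center: going outwards, the left copy
  -- is met in reverse.
  pairUp : List A → List (A × A)
  pairUp u = zip (reverse u) u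

  map-proj₁-zip : ∀ (u v : List A) → length u ≡ length v → map proj₁ (zip u v) ≡ u
  map-proj₁-zip []      []      _  = refl
  map-proj₁-zip (a ∷ u) (b ∷ v) eq = cong (a ∷_) (map-proj₁-zip u v (ℕ.suc-injective eq))

  map-proj₂-zip : ∀ (u v : List A) → length u ≡ length v → map proj₂ (zip u v) ≡ v
  map-proj₂-zip []      []      _  = refl
  map-proj₂-zip (a ∷ u) (b ∷ v) eq = cong (b ∷_) (map-proj₂-zip u v (ℕ.suc-injective eq))

  map-proj₁-pairUp : ∀ u → map proj₁ (pairUp u) ≡ reverse u
  map-proj₁-pairUp u = map-proj₁-zip (reverse u) u (length-reverse u)

  map-proj₂-pairUp : ∀ u → map proj₂ (pairUp u) ≡ u
  map-proj₂-pairUp u = map-proj₂-zip (reverse u) u (length-reverse u)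

  zip-map-proj : ∀ (z : List (A × A)) → zip (map proj₁ z) (map proj₂ z) ≡ z
  zip-map-proj []      = refl
  zip-map-proj (e ∷ z) = cong (e ∷_) (zip-map-proj z)

  map-proj₁-mirror : ∀ z → map proj₁ (mirror z) ≡ reverse (map proj₂ z)
  map-proj₁-mirror z = trans (reverse-map proj₁ (map swap z)) (cong reverse (sym (map-∘ z)))

  map-proj₂-mirror : ∀ z → map proj₂ (mirror z) ≡ reverse (map proj₁ z)
  map-proj₂-mirror z = trans (reverse-map proj₂ (map swap z)) (cong reverse (sym (map-∘ z)))

  -- Projecting the mirror equation expresses the first entries by the second ones. One letter per
  -- pair thus determines a palindrome, which is the saving that the count exploits.
  palindrome⇒pairUp : ∀ {q} → Palindrome q → q ≡ pairUp (map proj₂ q)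
  palindrome⇒pairUp {q} p = begin
    q                                          ≡⟨ zip-map-proj q ⟨
    zip (map proj₁ q) (map proj₂ q)            ≡⟨ cong (λ l → zip (map proj₁ l) (map proj₂ q)) p ⟨
    zip (map proj₁ (mirror q)) (map proj₂ q)   ≡⟨ cong (λ l → zip l (map proj₂ q)) (map-proj₁-mirror q) ⟩
    pairUp (map proj₂ q)                       ∎
    where open ≡-Reasoning

  pairUp-palindrome : ∀ u → Palindrome (pairUp u)
  pairUp-palindrome u = begin
    mirror q
      ≡⟨ zip-map-proj (mirror q) ⟨
    zip (map proj₁ (mirror q)) (map proj₂ (mirror q))
      ≡⟨ cong₂ zip
           (trans (map-proj₁-mirror q) (cong reverse (map-proj₂-pairUp u)))
           (trans (map-proj₂-mirror q)
             (trans (cong reverse (map-proj₁-pairUp u)) (reverse-involutive u))) ⟩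
    q ∎
    where
    open ≡-Reasoning
    q = pairUp u

  wrap-pairUp : ∀ u c → wrap (pairUp u) c ≡ u ++ c ++ u
  wrap-pairUp u c = trans (wrap≡ (pairUp u) c) (cong₂ (λ x y → x ++ c ++ y)
    (trans (cong reverse (map-proj₁-pairUp u)) (reverse-involutive u))
    (map-proj₂-pairUp u))

  wrap-palindrome : ∀ {q} → Palindrome q → ∀ c → wrap q c ≡ map proj₂ q ++ c ++ map proj₂ q
  wrap-palindrome {q} p c =
    trans (cong (λ l → wrap l c) (palindrome⇒pairUp p)) (wrap-pairUp (map proj₂ q) c)

  -- Blocks are listed from the outside in, but a `Factorization` begins at the center, so its head
  -- is the last block of the list.
  unfoldBlocks-∷ʳ : ∀ (us : List (List⁺ A)) u c →
    unfoldBlocks (us ∷ʳ u) c ≡ unfoldBlocks us (toList u ++ c ++ toList u)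
  unfoldBlocks-∷ʳ []       u c = begin
    unfoldBlocks (u ∷ []) c                    ≡⟨ unfoldBlocks-∷ u [] c ⟩
    toList u ++ (c ++ []) ++ toList u          ≡⟨ cong (λ l → toList u ++ l ++ toList u) (++-identityʳ c) ⟩
    toList u ++ c ++ toList u                  ≡⟨ ++-identityʳ _ ⟨
    (toList u ++ c ++ toList u) ++ []          ∎
    where open ≡-Reasoning
  unfoldBlocks-∷ʳ (v ∷ us) u c = begin
    unfoldBlocks (v ∷ us ∷ʳ u) c
      ≡⟨ unfoldBlocks-∷ v (us ∷ʳ u) c ⟩
    toList v ++ unfoldBlocks (us ∷ʳ u) c ++ toList v
      ≡⟨ cong (λ l → toList v ++ l ++ toList v) (unfoldBlocks-∷ʳ us u c) ⟩
    toList v ++ unfoldBlocks us (toList u ++ c ++ toList u) ++ toList v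
      ≡⟨ unfoldBlocks-∷ v us _ ⟨
    unfoldBlocks (v ∷ us) (toList u ++ c ++ toList u)
      ∎
    where open ≡-Reasoning

  factorization⇒blocks : ∀ {m x} → Factorization m x →
    ∃ λ us → length us ≡ m × (∀ c → wrap x c ≡ unfoldBlocks us c)
  factorization⇒blocks [] = [] , refl , λ c → sym (++-identityʳ c)
  factorization⇒blocks (_∷_ {e@(_ , b)} {q} {x = x} p f) with factorization⇒blocks f
  ... | us , refl , eq = us ∷ʳ u , trans (length-++ us) (ℕ.+-comm (length us) 1) , λ c → begin
    wrap ((e ∷ q) ++ x) c                        ≡⟨ wrap-++ (e ∷ q) x c ⟩
    wrap x (wrap (e ∷ q) c)                      ≡⟨ cong (wrap x) (wrap-palindrome p c) ⟩
    wrap x (toList u ++ c ++ toList u)           ≡⟨ eq _ ⟩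
    unfoldBlocks us (toList u ++ c ++ toList u)  ≡⟨ unfoldBlocks-∷ʳ us u c ⟨
    unfoldBlocks (us ∷ʳ u) c                     ∎
    where
    open ≡-Reasoning
    u : List⁺ A
    u = b List⁺.∷ map proj₂ q

  pairUp-factorization : ∀ u → Factorization 1 (pairUp (toList u))
  pairUp-factorization (a List⁺.∷ u) = go (pairUp (a ∷ u)) (pairUp-palindrome (a ∷ u))
    (trans (sym (length-map proj₂ (pairUp (a ∷ u)))) (cong length (map-proj₂-pairUp (a ∷ u))))
    where
    go : ∀ q → Palindrome q → length q ≡ suc (length u) → Factorization 1 q
    go (e ∷ q) p _ = proj₂ (palindrome⇒star p)

  blocks⇒factorization : ∀ us →
    ∃ λ x → Factorization (length us) x × (∀ c → wrap x c ≡ unfoldBlocks us c)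
  blocks⇒factorization [] = [] , [] , λ c → sym (++-identityʳ c)
  blocks⇒factorization (u ∷ us) with blocks⇒factorization us
  ... | x , f , eq = x ++ pairUp (toList u) ,
    subst (λ m → Factorization m (x ++ pairUp (toList u))) (ℕ.+-comm (length us) 1) (Factorization-++ f (pairUp-factorization u)) ,
    λ c → begin
      wrap (x ++ pairUp (toList u)) c            ≡⟨ wrap-++ x _ c ⟩
      wrap (pairUp (toList u)) (wrap x c)        ≡⟨ wrap-pairUp (toList u) _ ⟩
      toList u ++ wrap x c ++ toList u           ≡⟨ cong (λ l → toList u ++ l ++ toList u) (eq c) ⟩
      toList u ++ unfoldBlocks us c ++ toList u  ≡⟨ unfoldBlocks-∷ u us c ⟨
      unfoldBlocks (u ∷ us) c                    ∎
    where open ≡-Reasoning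

  -- Peel the pairs of `x` from the outside. A center of at most one letter has room for no pair, so
  -- all of them must come from `z`.
  wrap-split : ∀ x w z c → length c ≤ 1 → wrap x w ≡ wrap z c →
    ∃ λ y → z ≡ y ++ x × w ≡ wrap y c
  wrap-split []            w z c c≤1 eq = z , sym (++-identityʳ z) , eq
  wrap-split ((a , b) ∷ x) w z c c≤1 eq with wrap-split x (a ∷ w ∷ʳ b) z c c≤1 eq
  ... | y , refl , eq′ with initLast y
  ...   | [] = ⊥-elim (ℕ.<⇒≱ (subst (λ l → 1 < length l) eq′
                 (s≤s (subst (1 ≤_) (sym (length-++ w)) (ℕ.m≤n+m 1 (length w))))) c≤1)
  ...   | y′ ∷ʳ′ (a′ , b′) with ∷-injective (trans eq′ (wrap-++ y′ ((a′ , b′) ∷ []) c))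
  ...     | refl , eq″ with ∷ʳ-injective w (wrap y′ c) eq″
  ...       | w≡ , refl = y′ , ++-assoc y′ ((a , b) ∷ []) x , w≡

-- Width of a largest factorization

𝟙 : ∀ {P : Set} → Dec P → ℕ
𝟙 d = if does d then 1 else 0

𝟙-yes : ∀ {P : Set} (d : Dec P) → P → 𝟙 d ≡ 1
𝟙-yes (yes _) _ = refl
𝟙-yes (no ¬p) p = contradiction p ¬p

𝟙-no : ∀ {P : Set} (d : Dec P) → ¬ P → 𝟙 d ≡ 0
𝟙-no (yes p) ¬p = contradiction p ¬p
𝟙-no (no _)  _  = refl

module _ {A : Set} where

  wrap-empty : ∀ y (c : List A) → wrap y c ≡ [] → y ≡ []
  wrap-empty []      c _  = refl
  wrap-empty (e ∷ y) c eq = case trans (sym (length-wrap (e ∷ y) c)) (cong length eq) of λ ()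

  factorization-≤-length : ∀ {m} {x : List (A × A)} → Factorization m x → m ≤ length x
  factorization-≤-length [] = z≤n
  factorization-≤-length (_∷_ {e} {q} {m} {x} _ f) = s≤s (begin
    m                    ≤⟨ factorization-≤-length f ⟩
    length x             ≤⟨ ℕ.m≤n+m _ (length q) ⟩
    length q + length x  ≡⟨ length-++ q ⟨
    length (q ++ x)      ∎)
    where open ℕ.≤-Reasoning

module _ {A : Set} (_≟_ : DecidableEquality A) where

  opaque
    -- A concatenation of `m` palindromes is the same as `m` block pairs around an empty center, and
    -- `m` is at most the length.
    star? : Decidable (Star {A})
    star? x = map′ sound complete
      (ℕ.anyUpTo? (λ m → hasBlocks? _≟_ m empty? (wrap x [])) (suc (length x)))
      where
      empty? : Decidable {A = List A} (_≡ [])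
      empty? []      = yes refl
      empty? (_ ∷ _) = no λ ()
      sound : (∃ λ m → m < suc (length x) × HasBlocks _≟_ m (_≡ []) (wrap x [])) → Star x
      sound (_ , _ , us , _ , refl , eq , refl) with blocks⇒factorization us
      ... | x′ , f , eq′ with wrap-split x′ [] x [] z≤n (trans (eq′ []) (sym eq))
      ...   | y , refl , y≡ with wrap-empty y [] (sym y≡)
      ...     | refl = _ , f
      complete : Star x → ∃ λ m → m < suc (length x) × HasBlocks _≟_ m (_≡ []) (wrap x [])
      complete (m , f) with factorization⇒blocks f
      ... | us , len , eq = m , s≤s (factorization-≤-length f) , us , [] , len , eq [] , refl

  starSuffixes : List (A × A) → ℕ
  starSuffixes []      = 0
  starSuffixes (e ∷ z) = 𝟙 (star? (e ∷ z)) + starSuffixes z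

  -- Without a middle letter the center is empty just when the blocks use up all of `z`; a middle
  -- letter always lies in the center.
  centerWidth : List (A × A) → List A → ℕ
  centerWidth z []      = 1 ∸ 𝟙 (star? z)
  centerWidth z (_ ∷ _) = 1

  starSuffixes-++ : ∀ y x → starSuffixes x ≤ starSuffixes (y ++ x)
  starSuffixes-++ []      x = ℕ.≤-refl
  starSuffixes-++ (e ∷ y) x = ℕ.≤-trans (starSuffixes-++ y x) (ℕ.m≤n+m _ (𝟙 (star? ((e ∷ y) ++ x))))

  starSuffixes-star : ∀ {e y x} → Star ((e ∷ y) ++ x) → suc (starSuffixes x) ≤ starSuffixes ((e ∷ y) ++ x)
  starSuffixes-star {e} {y} {x} s =
    ℕ.+-mono-≤ (ℕ.≤-reflexive (sym (𝟙-yes (star? _) s))) (starSuffixes-++ y x)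

  factorization-≤-starSuffixes : ∀ {m x} → Factorization m x → m ≤ starSuffixes x
  factorization-≤-starSuffixes []      = z≤n
  factorization-≤-starSuffixes (_∷_ {q = q} p f) =
    ℕ.≤-trans (s≤s (factorization-≤-starSuffixes f)) (starSuffixes-star {y = q} (_ , p ∷ f))

  -- By `star-quotientʳ` the piece between two consecutive star suffixes is a nonempty
  -- concatenation, so each star suffix contributes at least one block.
  longestFactorization : ∀ z → ∃ λ y → ∃ λ x → ∃ λ m →
    z ≡ y ++ x × Factorization m x × starSuffixes z ≤ m
  longestFactorization [] = [] , [] , 0 , refl , [] , z≤n
  longestFactorization (e ∷ z) with longestFactorization z | star? (e ∷ z)
  ... | y , x , m , refl , f , le | no ¬s =
        e ∷ y , x , m , refl , f , le
  ... | y , x , m , refl , f , le | yes s with star-quotientʳ {x = e ∷ y} (m , f) s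
  ...   | m′ , g = [] , e ∷ y ++ x , m′ + m , refl , Factorization-++ g f ,
          ℕ.+-mono-≤ (nonempty g) le
    where
    nonempty : ∀ {m e} {y : List (A × A)} → Factorization m (e ∷ y) → 1 ≤ m
    nonempty (_ ∷ _) = s≤s z≤n

  width-≤ : ∀ z c → length c ≤ 1 → (g : BPFactorization (wrap z c)) →
    width g ≤ 2 * starSuffixes z + centerWidth z c
  width-≤ z c c≤1 (bp us w₀ eq) with blocks⇒factorization us
  ... | x , f , eq′ with wrap-split x w₀ z c c≤1 (trans (eq′ w₀) (sym eq))
  ...   | y , refl , refl = bound y c (≤M y)
    where
    n : ℕ
    n = length us
    ≤M : ∀ y → n ≤ starSuffixes (y ++ x)
    ≤M y = ℕ.≤-trans (factorization-≤-starSuffixes f) (starSuffixes-++ y x)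
    odd : ∀ w → widthOf n w ≤ 2 * n + 1
    odd []      = ℕ.m≤m+n (2 * n) 1
    odd (_ ∷ _) = ℕ.≤-refl
    bound : ∀ y c → n ≤ starSuffixes (y ++ x) →
      widthOf n (wrap y c) ≤ 2 * starSuffixes (y ++ x) + centerWidth (y ++ x) c
    bound y       (a ∷ c) le = ℕ.≤-trans (odd (wrap y (a ∷ c))) (ℕ.+-monoˡ-≤ 1 (ℕ.*-monoʳ-≤ 2 le))
    bound []      []      le = ℕ.≤-trans (ℕ.*-monoʳ-≤ 2 le) (ℕ.m≤m+n _ _)
    bound (e ∷ y) []      le with star? ((e ∷ y) ++ x)
    ... | no  _ = ℕ.≤-trans (odd (wrap (e ∷ y) [])) (ℕ.+-monoˡ-≤ 1 (ℕ.*-monoʳ-≤ 2 le))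
    -- The center is nonempty, yet the whole word is a concatenation too. It is a star suffix beyond
    -- those of `y ++ x`, and it pays for the odd width.
    ... | yes s = begin
      widthOf n (wrap (e ∷ y) [])               ≤⟨ odd (wrap (e ∷ y) []) ⟩
      2 * n + 1                                 ≤⟨ ℕ.+-monoʳ-≤ (2 * n) (s≤s z≤n) ⟩
      2 * n + 2                                 ≡⟨ trans (ℕ.+-comm (2 * n) 2) (sym (ℕ.*-suc 2 n)) ⟩
      2 * suc n                                 ≤⟨ ℕ.*-monoʳ-≤ 2 (s≤s (≤M y)) ⟩
      2 * suc (starSuffixes (y ++ x))           ≡⟨ ℕ.+-identityʳ _ ⟨
      2 * suc (starSuffixes (y ++ x)) + 0       ∎
      where open ℕ.≤-Reasoning

  -- The blocks of `longestFactorization` around `wrap y c` attain the bound: if `c` is empty and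
  -- `z` is no concatenation, then `y` is nonempty and so is the center.
  largestWidth : ∀ z c → length c ≤ 1 → LargestWidth (wrap z c) (2 * starSuffixes z + centerWidth z c)
  largestWidth z c c≤1 with longestFactorization z
  ... | y , x , m , refl , f , le with factorization⇒blocks f
  ...   | us , refl , eq = g , (λ h → ℕ.≤-trans (width-≤ z c c≤1 h) wide) ,
          ℕ.≤-antisym (width-≤ z c c≤1 g) wide
    where
    g : BPFactorization (wrap z c)
    g = bp us (wrap y c) (trans (wrap-++ y x c) (eq (wrap y c)))
    lower : ∀ w → 2 * length us ≤ widthOf (length us) w
    lower []      = ℕ.≤-refl
    lower (_ ∷ _) = ℕ.m≤m+n _ 1
    lower⁺ : ∀ w → w ≢ [] → 2 * length us + 1 ≤ widthOf (length us) w
    lower⁺ []      w≢[] = contradiction refl w≢[]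
    lower⁺ (_ ∷ _) _    = ℕ.≤-refl
    wide : 2 * starSuffixes z + centerWidth z c ≤ widthOf (length us) (wrap y c)
    wide = centered c
      where
      strict : ∀ c → wrap y c ≢ [] → 2 * starSuffixes z + 1 ≤ widthOf (length us) (wrap y c)
      strict c ne = ℕ.≤-trans (ℕ.+-monoˡ-≤ 1 (ℕ.*-monoʳ-≤ 2 le)) (lower⁺ (wrap y c) ne)
      centered : ∀ c → 2 * starSuffixes z + centerWidth z c ≤ widthOf (length us) (wrap y c)
      centered (a ∷ c) = strict (a ∷ c) λ w≡[] →
        case subst (λ y → wrap y (a ∷ c) ≡ []) (wrap-empty y (a ∷ c) w≡[]) w≡[] of λ ()
      centered [] with star? z
      ... | yes s = ℕ.≤-trans (ℕ.≤-reflexive (ℕ.+-identityʳ (2 * starSuffixes z)))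
              (ℕ.≤-trans (ℕ.*-monoʳ-≤ 2 le) (lower (wrap y [])))
      ... | no ¬s = strict [] λ w≡[] → contradiction
              (length us , subst (λ y → Factorization (length us) (y ++ x)) (sym (wrap-empty y [] w≡[])) f) ¬s

-- Sums over words

∑ : {A : Set} → List A → (A → ℕ) → ℕ
∑ xs f = sum (map f xs)

∑-cong : ∀ {A : Set} (xs : List A) {f g} → (∀ x → f x ≡ g x) → ∑ xs f ≡ ∑ xs g
∑-cong xs f≗g = cong sum (map-cong f≗g xs)

∑-mono : ∀ {A : Set} (xs : List A) {f g} → (∀ x → f x ≤ g x) → ∑ xs f ≤ ∑ xs g
∑-mono []       le = z≤n
∑-mono (x ∷ xs) le = ℕ.+-mono-≤ (le x) (∑-mono xs le)

∑-+ : ∀ {A : Set} (xs : List A) f g → ∑ xs (λ x → f x + g x) ≡ ∑ xs f + ∑ xs g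
∑-+ []       f g = refl
∑-+ (x ∷ xs) f g = trans (cong (f x + g x +_) (∑-+ xs f g))
  (solve 4 (λ a b c d → a :+ b :+ (c :+ d) := a :+ c :+ (b :+ d)) refl (f x) (g x) (∑ xs f) (∑ xs g))
  where open +-*-Solver

∑-* : ∀ {A : Set} (xs : List A) c f → ∑ xs (λ x → c * f x) ≡ c * ∑ xs f
∑-* []       c f = sym (ℕ.*-zeroʳ c)
∑-* (x ∷ xs) c f = trans (cong (c * f x +_) (∑-* xs c f)) (sym (ℕ.*-distribˡ-+ c (f x) _))

∑-const : ∀ {A : Set} (xs : List A) c → ∑ xs (λ _ → c) ≡ length xs * c
∑-const []       c = refl
∑-const (x ∷ xs) c = cong (c +_) (∑-const xs c)

∑-++ : ∀ {A : Set} (xs ys : List A) f → ∑ (xs ++ ys) f ≡ ∑ xs f + ∑ ys f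
∑-++ xs ys f = trans (cong sum (map-++ f xs ys)) (sum-++ (map f xs) (map f ys))

∑-swap : ∀ {A B : Set} (xs : List A) (ys : List B) (f : A → B → ℕ) →
  ∑ xs (λ x → ∑ ys (f x)) ≡ ∑ ys (λ y → ∑ xs (λ x → f x y))
∑-swap []       ys f = sym (trans (∑-const ys 0) (ℕ.*-zeroʳ (length ys)))
∑-swap (x ∷ xs) ys f = trans (cong (∑ ys (f x) +_) (∑-swap xs ys f)) (sym (∑-+ ys (f x) _))

∑-cartesianProductWith : ∀ {A B C : Set} (g : A → B → C) xs ys f →
  ∑ (cartesianProductWith g xs ys) f ≡ ∑ xs (λ x → ∑ ys (λ y → f (g x y)))
∑-cartesianProductWith g []       ys f = refl
∑-cartesianProductWith g (x ∷ xs) ys f = trans (∑-++ (map (g x) ys) _ f)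
  (cong₂ _+_ (cong sum (sym (map-∘ ys))) (∑-cartesianProductWith g xs ys f))

length-filter≡∑ : ∀ {A : Set} {P : A → Set} (P? : Decidable P) xs → length (filter P? xs) ≡ ∑ xs (𝟙 ∘ P?)
length-filter≡∑ P? [] = refl
length-filter≡∑ P? (x ∷ xs) with does (P? x)
... | true  = cong suc (length-filter≡∑ P? xs)
... | false = length-filter≡∑ P? xs

-- Nested sums instead of a list of words let letters be split off at either end.
∑ⁿ : {A : Set} → List A → ℕ → (List A → ℕ) → ℕ
∑ⁿ xs zero    f = f []
∑ⁿ xs (suc n) f = ∑ xs (λ x → ∑ⁿ xs n (f ∘ (x ∷_)))

module _ {A : Set} (xs : List A) where

  ∑ⁿ-cong : ∀ n {f g : List A → ℕ} → (∀ w → length w ≡ n → f w ≡ g w) → ∑ⁿ xs n f ≡ ∑ⁿ xs n g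
  ∑ⁿ-cong zero    eq = eq [] refl
  ∑ⁿ-cong (suc n) eq = ∑-cong xs λ x → ∑ⁿ-cong n λ w len → eq (x ∷ w) (cong suc len)

  ∑ⁿ-mono : ∀ n {f g : List A → ℕ} → (∀ w → length w ≡ n → f w ≤ g w) → ∑ⁿ xs n f ≤ ∑ⁿ xs n g
  ∑ⁿ-mono zero    le = le [] refl
  ∑ⁿ-mono (suc n) le = ∑-mono xs λ x → ∑ⁿ-mono n λ w len → le (x ∷ w) (cong suc len)

  ∑ⁿ-+ : ∀ n (f g : List A → ℕ) → ∑ⁿ xs n (λ w → f w + g w) ≡ ∑ⁿ xs n f + ∑ⁿ xs n g
  ∑ⁿ-+ zero    f g = refl
  ∑ⁿ-+ (suc n) f g = trans (∑-cong xs λ x → ∑ⁿ-+ n (f ∘ (x ∷_)) (g ∘ (x ∷_))) (∑-+ xs _ _)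

  ∑ⁿ-* : ∀ n c (f : List A → ℕ) → ∑ⁿ xs n (λ w → c * f w) ≡ c * ∑ⁿ xs n f
  ∑ⁿ-* zero    c f = refl
  ∑ⁿ-* (suc n) c f = trans (∑-cong xs λ x → ∑ⁿ-* n c (f ∘ (x ∷_))) (∑-* xs c _)

  ∑ⁿ-const : ∀ n c → ∑ⁿ xs n (λ _ → c) ≡ length xs ^ n * c
  ∑ⁿ-const zero    c = sym (ℕ.+-identityʳ c)
  ∑ⁿ-const (suc n) c = begin
    ∑ xs (λ _ → ∑ⁿ xs n (λ _ → c))  ≡⟨ ∑-const xs _ ⟩
    length xs * ∑ⁿ xs n (λ _ → c)   ≡⟨ cong (length xs *_) (∑ⁿ-const n c) ⟩
    length xs * (length xs ^ n * c) ≡⟨ ℕ.*-assoc (length xs) _ c ⟨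
    length xs ^ suc n * c           ∎
    where open ≡-Reasoning

  ∑-∑ⁿ-swap : ∀ {B : Set} (ys : List B) n (f : B → List A → ℕ) →
    ∑ ys (λ y → ∑ⁿ xs n (f y)) ≡ ∑ⁿ xs n (λ w → ∑ ys (λ y → f y w))
  ∑-∑ⁿ-swap ys zero    f = refl
  ∑-∑ⁿ-swap ys (suc n) f = trans (∑-swap ys xs _)
    (∑-cong xs λ x → ∑-∑ⁿ-swap ys n (λ y → f y ∘ (x ∷_)))

  ∑ⁿ-∷ʳ : ∀ n f → ∑ⁿ xs (suc n) f ≡ ∑ⁿ xs n (λ w → ∑ xs (λ x → f (w ∷ʳ x)))
  ∑ⁿ-∷ʳ zero    f = refl
  ∑ⁿ-∷ʳ (suc n) f = ∑-cong xs λ x → ∑ⁿ-∷ʳ n (f ∘ (x ∷_))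

-- The induction takes the innermost pair out of the center: a center of length `r + 2` is a first
-- letter, a center of length `r` and a last letter.
∑ⁿ-wrap : ∀ {A : Set} (xs : List A) h r f →
  ∑ⁿ xs (h + (h + r)) f ≡ ∑ⁿ (cartesianProduct xs xs) h (λ z → ∑ⁿ xs r (f ∘ wrap z))
∑ⁿ-wrap xs zero    r f = refl
∑ⁿ-wrap {A} xs (suc h) r f = begin
  ∑ⁿ xs (suc h + (suc h + r)) f
    ≡⟨ cong (λ n → ∑ⁿ xs n f) (solve 2 (λ h r →
         con 1 :+ h :+ (con 1 :+ h :+ r) := h :+ (h :+ (con 2 :+ r))) refl h r) ⟩
  ∑ⁿ xs (h + (h + suc (suc r))) f
    ≡⟨ ∑ⁿ-wrap xs h (suc (suc r)) f ⟩
  ∑ⁿ ps h (λ z → ∑ xs (λ a → ∑ⁿ xs (suc r) (λ c → f (wrap z (a ∷ c)))))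
    ≡⟨ ∑ⁿ-cong ps h (λ z _ → ∑-cong xs λ a → trans (∑ⁿ-∷ʳ xs r (λ c → f (wrap z (a ∷ c)))) (sym (∑-∑ⁿ-swap xs xs r _))) ⟩
  ∑ⁿ ps h (λ z → ∑ xs (λ a → ∑ xs (λ b → ∑ⁿ xs r (λ c → f (wrap z (a ∷ c ∷ʳ b))))))
    ≡⟨ ∑ⁿ-cong ps h (λ z _ → ∑-cartesianProductWith _,_ xs xs _) ⟨
  ∑ⁿ ps h (λ z → ∑ ps (λ e → ∑ⁿ xs r (λ c → f (wrap (e ∷ z) c))))
    ≡⟨ ∑-∑ⁿ-swap ps ps h _ ⟨
  ∑ ps (λ e → ∑ⁿ ps h (λ z → ∑ⁿ xs r (λ c → f (wrap (e ∷ z) c))))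
    ∎
  where
  open ≡-Reasoning
  open +-*-Solver
  ps : List (A × A)
  ps = cartesianProduct xs xs

∑-words : ∀ k n f → ∑ (words k n) f ≡ ∑ⁿ (allFin k) n f
∑-words k zero    f = ℕ.+-identityʳ (f [])
∑-words k (suc n) f = trans (∑-cartesianProductWith _∷_ (allFin k) (words k n) f)
  (∑-cong (allFin k) λ a → ∑-words k n (f ∘ (a ∷_)))

∑-applyUpTo-suc : ∀ n f → ∑ (applyUpTo suc (suc n)) f ≡ ∑ (applyUpTo suc n) f + f (suc n)
∑-applyUpTo-suc n f = begin
  ∑ (applyUpTo suc (suc n)) f              ≡⟨ cong (λ l → ∑ l f) (applyUpTo-∷ʳ suc n) ⟨
  ∑ (applyUpTo suc n ∷ʳ suc n) f           ≡⟨ ∑-++ (applyUpTo suc n) (suc n ∷ []) f ⟩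
  ∑ (applyUpTo suc n) f + (f (suc n) + 0)  ≡⟨ cong (∑ (applyUpTo suc n) f +_) (ℕ.+-identityʳ _) ⟩
  ∑ (applyUpTo suc n) f + f (suc n)        ∎
  where open ≡-Reasoning

∑-applyUpTo-zero : ∀ n f → (∀ i → i ≤ n → f i ≡ 0) → ∑ (applyUpTo suc n) f ≡ 0
∑-applyUpTo-zero zero    f f≡0 = refl
∑-applyUpTo-zero (suc n) f f≡0 = trans (∑-applyUpTo-suc n f)
  (cong₂ _+_ (∑-applyUpTo-zero n f λ i i≤n → f≡0 i (ℕ.m≤n⇒m≤1+n i≤n)) (f≡0 (suc n) ℕ.≤-refl))

-- The sum starts at 1, so `f 0 ≡ 0` takes care of `j = 0`, the width of the empty word.
∑-applyUpTo-single : ∀ n f j → j ≤ n → (∀ i → i ≢ j → f i ≡ 0) → f 0 ≡ 0 → ∑ (applyUpTo suc n) f ≡ f j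
∑-applyUpTo-single zero    f .0 z≤n f≡0 f0≡0 = sym f0≡0
∑-applyUpTo-single (suc n) f j j≤n f≡0 f0≡0 with ℕ.m≤n⇒m<n∨m≡n j≤n
... | inj₁ (s≤s j≤n′) = trans (∑-applyUpTo-suc n f) (trans
        (cong₂ _+_ (∑-applyUpTo-single n f j j≤n′ f≡0 f0≡0) (f≡0 (suc n) λ eq → ℕ.<⇒≢ (s≤s j≤n′) (sym eq)))
        (ℕ.+-identityʳ (f j)))
... | inj₂ refl = trans (∑-applyUpTo-suc n f)
        (cong (_+ f (suc n)) (∑-applyUpTo-zero n f λ i i≤n → f≡0 i (ℕ.<⇒≢ (s≤s i≤n))))

largestWidth-unique : ∀ {A : Set} {w : List A} {i j} → LargestWidth w i → LargestWidth w j → i ≡ j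
largestWidth-unique (f , f-max , refl) (g , g-max , refl) = ℕ.≤-antisym (g-max f) (f-max g)

-- Total width in terms of the number of concatenations

module _ (k : ℕ) where

  private
    letters : List (Fin k)
    letters = allFin k
    pairs : List (Fin k × Fin k)
    pairs = cartesianProduct letters letters
    K : ℕ
    K = k * k

  starCount : ℕ → ℕ
  starCount h = ∑ⁿ pairs h (𝟙 ∘ star? Fin._≟_)

  starSuffixCount : ℕ → ℕ
  starSuffixCount h = ∑ⁿ pairs h (starSuffixes Fin._≟_)

  totalWidth : ℕ → ℕ
  totalWidth n = sum (map (λ i → i * IB k n i) (applyUpTo suc n))

  length-letters : length letters ≡ k
  length-letters = length-tabulate {n = k} (λ i → i)

  ∑-pairs-const : ∀ c → ∑ pairs (λ _ → c) ≡ K * c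
  ∑-pairs-const c = begin
    ∑ pairs (λ _ → c)                      ≡⟨ ∑-cartesianProductWith _,_ letters letters (λ _ → c) ⟩
    ∑ letters (λ _ → ∑ letters (λ _ → c))  ≡⟨ trans (∑-const letters _) (cong (length letters *_) (∑-const letters c)) ⟩
    length letters * (length letters * c)  ≡⟨ cong (λ l → l * (l * c)) length-letters ⟩
    k * (k * c)                            ≡⟨ ℕ.*-assoc k k c ⟨
    K * c                                  ∎
    where open ≡-Reasoning

  length-pairs : length pairs ≡ K
  length-pairs = begin
    length pairs       ≡⟨ ℕ.*-identityʳ _ ⟨
    length pairs * 1   ≡⟨ ∑-const pairs 1 ⟨
    ∑ pairs (λ _ → 1)  ≡⟨ ∑-pairs-const 1 ⟩
    K * 1              ≡⟨ ℕ.*-identityʳ K ⟩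
    K                  ∎
    where open ≡-Reasoning

  -- The full word contributes `starCount (suc h)`. The proper suffixes ignore the first pair, which
  -- has `K` values.
  starSuffixCount-suc : ∀ h → starSuffixCount (suc h) ≡ starCount (suc h) + K * starSuffixCount h
  starSuffixCount-suc h = trans (∑-cong pairs λ e → ∑ⁿ-+ pairs h _ _)
    (trans (∑-+ pairs _ _) (cong (starCount (suc h) +_) (∑-pairs-const (starSuffixCount h))))

  -- Exchange the sums over widths and words: a word has exactly one largest width, so its inner sum
  -- collapses to that width.
  totalWidth-pairs : ∀ h r → r ≤ 1 → totalWidth (h + (h + r)) ≡
    ∑ⁿ pairs h (λ z → ∑ⁿ letters r (λ c → 2 * starSuffixes Fin._≟_ z + centerWidth Fin._≟_ z c))
  totalWidth-pairs h r r≤1 = begin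
    ∑ is (λ i → i * IB k n i)
      ≡⟨ ∑-cong is (λ i → trans
           (cong (i *_) (trans (length-filter≡∑ (largestWidth? Fin._≟_ i) (words k n)) (∑-words k n _)))
           (sym (∑ⁿ-* letters n i _))) ⟩
    ∑ is (λ i → ∑ⁿ letters n (λ w → i * 𝟙 (largestWidth? Fin._≟_ i w)))
      ≡⟨ ∑-∑ⁿ-swap letters is n _ ⟩
    ∑ⁿ letters n (λ w → ∑ is (λ i → i * 𝟙 (largestWidth? Fin._≟_ i w)))
      ≡⟨ ∑ⁿ-wrap letters h r _ ⟩
    ∑ⁿ pairs h (λ z → ∑ⁿ letters r (λ c → ∑ is (λ i → i * 𝟙 (largestWidth? Fin._≟_ i (wrap z c)))))
      ≡⟨ ∑ⁿ-cong pairs h (λ z lz → ∑ⁿ-cong letters r λ c lc →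
           ∑-largestWidth (wrap z c) _ (subst (_≡ n) (sym (length-wrap z c)) (cong₂ (λ a b → a + (a + b)) lz lc))
             (largestWidth Fin._≟_ z c (subst (_≤ 1) (sym lc) r≤1))) ⟩
    ∑ⁿ pairs h (λ z → ∑ⁿ letters r (λ c → 2 * starSuffixes Fin._≟_ z + centerWidth Fin._≟_ z c))
      ∎
    where
    open ≡-Reasoning
    n : ℕ
    n = h + (h + r)
    is : List ℕ
    is = applyUpTo suc n
    f≡0 : ∀ w j i → LargestWidth w j → i ≢ j → i * 𝟙 (largestWidth? Fin._≟_ i w) ≡ 0
    f≡0 w j i lw i≢j = trans
      (cong (i *_) (𝟙-no (largestWidth? Fin._≟_ i w) λ lw′ → i≢j (largestWidth-unique lw′ lw)))
      (ℕ.*-zeroʳ i)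
    f≡j : ∀ w j → LargestWidth w j → j * 𝟙 (largestWidth? Fin._≟_ j w) ≡ j
    f≡j w j lw = trans (cong (j *_) (𝟙-yes (largestWidth? Fin._≟_ j w) lw)) (ℕ.*-identityʳ j)
    ∑-largestWidth : ∀ w j → length w ≡ n → LargestWidth w j →
      ∑ is (λ i → i * 𝟙 (largestWidth? Fin._≟_ i w)) ≡ j
    ∑-largestWidth w j len lw@(f , _ , refl) = trans
      (∑-applyUpTo-single n _ j (subst (j ≤_) len (width≤length f)) (λ i → f≡0 w j i lw) refl) (f≡j w j lw)

  -- Each concatenation lacks the unit of width given by a nonempty center. Adding `starCount h` on
  -- the left avoids truncated subtraction.
  totalWidth-even : ∀ h → totalWidth (h + (h + 0)) + starCount h ≡ 2 * starSuffixCount h + K ^ h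
  totalWidth-even h = begin
    totalWidth (h + (h + 0)) + starCount h
      ≡⟨ cong (_+ starCount h) (totalWidth-pairs h 0 z≤n) ⟩
    ∑ⁿ pairs h (λ z → 2 * M z + (1 ∸ s z)) + ∑ⁿ pairs h s
      ≡⟨ ∑ⁿ-+ pairs h _ s ⟨
    ∑ⁿ pairs h (λ z → 2 * M z + (1 ∸ s z) + s z)
      ≡⟨ ∑ⁿ-cong pairs h (λ z _ → trans (ℕ.+-assoc (2 * M z) _ _) (cong (2 * M z +_) (complement (star? Fin._≟_ z)))) ⟩
    ∑ⁿ pairs h (λ z → 2 * M z + 1)
      ≡⟨ ∑ⁿ-+ pairs h _ _ ⟩
    ∑ⁿ pairs h (λ z → 2 * M z) + ∑ⁿ pairs h (λ _ → 1)
      ≡⟨ cong₂ _+_ (∑ⁿ-* pairs h 2 M) (trans (∑ⁿ-const pairs h 1)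
           (trans (ℕ.*-identityʳ _) (cong (_^ h) length-pairs))) ⟩
    2 * starSuffixCount h + K ^ h
      ∎
    where
    open ≡-Reasoning
    M : List (Fin k × Fin k) → ℕ
    M = starSuffixes Fin._≟_
    s : List (Fin k × Fin k) → ℕ
    s = 𝟙 ∘ star? Fin._≟_
    complement : ∀ {P : Set} (d : Dec P) → 1 ∸ 𝟙 d + 𝟙 d ≡ 1
    complement (yes _) = refl
    complement (no  _) = refl

  totalWidth-odd : ∀ h → totalWidth (h + (h + 1)) ≡ k * (2 * starSuffixCount h + K ^ h)
  totalWidth-odd h = begin
    totalWidth (h + (h + 1))
      ≡⟨ totalWidth-pairs h 1 ℕ.≤-refl ⟩
    ∑ⁿ pairs h (λ z → ∑ letters (λ _ → 2 * M z + 1))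
      ≡⟨ ∑ⁿ-cong pairs h (λ z _ → trans (∑-const letters _) (cong (_* (2 * M z + 1)) length-letters)) ⟩
    ∑ⁿ pairs h (λ z → k * (2 * M z + 1))
      ≡⟨ ∑ⁿ-* pairs h k _ ⟩
    k * ∑ⁿ pairs h (λ z → 2 * M z + 1)
      ≡⟨ cong (k *_) (trans (∑ⁿ-+ pairs h _ _) (cong₂ _+_ (∑ⁿ-* pairs h 2 M) (trans (∑ⁿ-const pairs h 1)
           (trans (ℕ.*-identityʳ _) (cong (_^ h) length-pairs))))) ⟩
    k * (2 * starSuffixCount h + K ^ h)
      ∎
    where
    open ≡-Reasoning
    M : List (Fin k × Fin k) → ℕ
    M = starSuffixes Fin._≟_

-- Growth of the number of concatenations of palindromes

𝟙-≤ : ∀ {P : Set} {n} (d : Dec P) → (P → 1 ≤ n) → 𝟙 d ≤ n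
𝟙-≤ (yes p) le = le p
𝟙-≤ (no _)  _  = z≤n

module _ {A : Set} (_≟_ : DecidableEquality A) where

  ∑-≟-All : ∀ {xs b} → All (b ≢_) xs → ∑ xs (λ x → 𝟙 (x ≟ b)) ≡ 0
  ∑-≟-All []         = refl
  ∑-≟-All (b≢x ∷ ps) = cong₂ _+_ (𝟙-no (_ ≟ _) (b≢x ∘ sym)) (∑-≟-All ps)

  ∑-≟-≤1 : ∀ {xs} → Unique xs → ∀ b → ∑ xs (λ x → 𝟙 (x ≟ b)) ≤ 1
  ∑-≟-≤1 []                 b = z≤n
  ∑-≟-≤1 (_∷_ {x} x∉ uniq) b with x ≟ b
  ... | yes refl = ℕ.≤-reflexive (cong suc (∑-≟-All x∉))
  ... | no _     = ∑-≟-≤1 uniq b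

  -- Only an inequality, since `y` may have another length or letters outside `xs`.
  ∑ⁿ-≟-≤1 : ∀ {xs} → Unique xs → ∀ n y → ∑ⁿ xs n (λ w → 𝟙 (≡-dec _≟_ w y)) ≤ 1
  ∑ⁿ-≟-≤1 uniq zero    y = 𝟙-≤ (≡-dec _≟_ [] y) λ _ → ℕ.≤-refl
  ∑ⁿ-≟-≤1 {xs} uniq (suc n) [] = ℕ.≤-trans (ℕ.≤-reflexive zeros) z≤n
    where
    zeros : ∑ⁿ xs (suc n) (λ w → 𝟙 (≡-dec _≟_ w [])) ≡ 0
    zeros = trans (∑-cong xs λ x → trans (∑ⁿ-const xs n 0) (ℕ.*-zeroʳ (length xs ^ n)))
      (trans (∑-const xs 0) (ℕ.*-zeroʳ (length xs)))
  ∑ⁿ-≟-≤1 {xs} uniq (suc n) (b ∷ y) = begin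
    ∑ xs (λ x → ∑ⁿ xs n (λ w → 𝟙 (≡-dec _≟_ (x ∷ w) (b ∷ y))))
      ≤⟨ ∑-mono xs (λ x → ∑ⁿ-mono xs n λ w _ → split x w) ⟩
    ∑ xs (λ x → ∑ⁿ xs n (λ w → 𝟙 (x ≟ b) * 𝟙 (≡-dec _≟_ w y)))
      ≡⟨ ∑-cong xs (λ x → ∑ⁿ-* xs n (𝟙 (x ≟ b)) _) ⟩
    ∑ xs (λ x → 𝟙 (x ≟ b) * ∑ⁿ xs n (λ w → 𝟙 (≡-dec _≟_ w y)))
      ≤⟨ ∑-mono xs (λ x → ℕ.≤-trans (ℕ.*-monoʳ-≤ (𝟙 (x ≟ b)) (∑ⁿ-≟-≤1 uniq n y)) (ℕ.≤-reflexive (ℕ.*-identityʳ _))) ⟩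
    ∑ xs (λ x → 𝟙 (x ≟ b))
      ≤⟨ ∑-≟-≤1 uniq b ⟩
    1 ∎
    where
    open ℕ.≤-Reasoning
    split : ∀ x w → 𝟙 (≡-dec _≟_ (x ∷ w) (b ∷ y)) ≤ 𝟙 (x ≟ b) * 𝟙 (≡-dec _≟_ w y)
    split x w = 𝟙-≤ (≡-dec _≟_ (x ∷ w) (b ∷ y)) λ { refl →
      ℕ.≤-reflexive (sym (cong₂ _*_ (𝟙-yes (x ≟ b) refl) (𝟙-yes (≡-dec _≟_ w y) refl))) }

∈⇒≤∑ : ∀ {A : Set} {x : A} {xs} f → x ∈ xs → f x ≤ ∑ xs f
∈⇒≤∑ f (here refl) = ℕ.m≤m+n _ _
∈⇒≤∑ f (there x∈)  = ℕ.≤-trans (∈⇒≤∑ f x∈) (ℕ.m≤n+m _ _)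

length-concatMap : ∀ {A B : Set} (f : A → List B) xs → length (concatMap f xs) ≡ ∑ xs (length ∘ f)
length-concatMap f []       = refl
length-concatMap f (x ∷ xs) = trans (length-++ (f x)) (cong (length (f x) +_) (length-concatMap f xs))

-- A list covering all concatenations

module _ (k′ : ℕ) where

  private
    k : ℕ
    k = suc k′
    X : Set
    X = Fin k × Fin k

  mutual
    -- Contains all concatenations of palindromes. A palindrome of length at least 2 that starts with
    -- (a , a) also ends with it, and splitting off both ends leaves a palindrome; hence a block is
    -- (a , a) alone, or it starts with (a , b) and ends with (b , a) for some b ≢ a.
    starWords : ℕ → List (List X)
    starWords zero    = [] ∷ []
    starWords (suc n) =
      concatMap (equalStart n) (allFin k) ++
      concatMap (distinctStart n) (cartesianProduct (allFin k) (allFin k′))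

    equalStart : ℕ → Fin k → List (List X)
    equalStart n a = map ((a , a) ∷_) (starWords n)

    distinctStart : ℕ → Fin k × Fin k′ → List (List X)
    distinctStart n (a , j) = map ((a , punchIn a j) ∷_) (openWords (punchIn a j , a) [] n)

    -- Completions of a block that will end in e, whose inner part is pairUp of a word chosen letter
    -- by letter and accumulated in u.
    openWords : X → List (Fin k) → ℕ → List (List X)
    -- No pair is left for the closing `e`.
    openWords e u zero    = []
    openWords e u (suc n) =
      map (λ z → pairUp u ++ e ∷ z) (starWords n) ++
      concatMap (λ c → openWords e (c ∷ u) n) (allFin k)

  equalStart-∈ : ∀ n a {z} → z ∈ starWords n → (a , a) ∷ z ∈ starWords (suc n)
  equalStart-∈ n a z∈ =
    ∈-++⁺ˡ (∈-concatMap⁺ (equalStart n) (lose (∈-allFin a) (∈-map⁺ ((a , a) ∷_) z∈)))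

  distinctStart-∈ : ∀ n a j {z} → z ∈ openWords (punchIn a j , a) [] n →
    (a , punchIn a j) ∷ z ∈ starWords (suc n)
  distinctStart-∈ n a j z∈ = ∈-++⁺ʳ (concatMap (equalStart n) (allFin k))
    (∈-concatMap⁺ (distinctStart n)
      (lose (∈-cartesianProduct⁺ (∈-allFin a) (∈-allFin j)) (∈-map⁺ ((a , punchIn a j) ∷_) z∈)))

  -- `v` holds the letters still to be chosen; they pile up on `u` in reverse. The index counts the
  -- pairs not yet fixed: those of `v`, the closing `e` and those of `x`.
  openWords-∈ : ∀ e v u x → x ∈ starWords (length x) →
    pairUp (v ʳ++ u) ++ e ∷ x ∈ openWords e u (length v + suc (length x))
  openWords-∈ e []      u x x∈ = ∈-++⁺ˡ (∈-map⁺ (λ z → pairUp u ++ e ∷ z) x∈)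
  openWords-∈ e (c ∷ v) u x x∈ =
    ∈-++⁺ʳ (map (λ z → pairUp u ++ e ∷ z) (starWords (length v + suc (length x))))
      (∈-concatMap⁺ (λ c → openWords e (c ∷ u) (length v + suc (length x)))
        (lose (∈-allFin c) (openWords-∈ e v (c ∷ u) x x∈)))

  ∷-palindrome : ∀ {a b e} {m : List X} → Palindrome ((a , b) ∷ m ∷ʳ e) → e ≡ (b , a) × Palindrome m
  ∷-palindrome {a} {b} {e} {m} p with ∷ʳ-injective (mirror m) m (∷-injectiveʳ (trans (sym flipped) p))
    where
    flipped : mirror ((a , b) ∷ m ∷ʳ e) ≡ swap e ∷ mirror m ∷ʳ (b , a)
    flipped = trans (mirror-++ ((a , b) ∷ []) (m ∷ʳ e)) (cong (_∷ʳ (b , a)) (mirror-++ m (e ∷ [])))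
  ... | pm , eq = sym eq , pm

  -- Induction on a length bound, because for equal entries the remainder `m ++ (a , a) ∷ x` gets a
  -- newly built factorization that is no part of the given one.
  starWords-∈ : ∀ n z → length z ≤ n → Star z → z ∈ starWords (length z)
  starWords-∈ n .[] _ (_ , []) = here refl
  starWords-∈ (suc n) _ z≤ (_ , _∷_ {a , b} {q} {x = x} p f) with initLast q
  ... | [] with ∷-injective p
  ...   | refl , _ = equalStart-∈ (length x) a (starWords-∈ n x (ℕ.s≤s⁻¹ z≤) (_ , f))
  starWords-∈ (suc n) _ z≤ (_ , _∷_ {a , b} {_} {x = x} p f) | m ∷ʳ′ e with ∷-palindrome {m = m} p
  ... | refl , pm rewrite ++-assoc m ((b , a) ∷ []) x = cases (a Fin.≟ b)
    where
    x≤ : length x ≤ n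
    x≤ = ℕ.≤-trans (ℕ.n≤1+n _) (ℕ.≤-trans (ℕ.m≤n+m _ (length m))
      (subst (_≤ n) (length-++ m) (ℕ.s≤s⁻¹ z≤)))
    distinct : ∀ j → (a , punchIn a j) ∷ m ++ (punchIn a j , a) ∷ x ∈
      starWords (suc (length (m ++ (punchIn a j , a) ∷ x)))
    distinct j = distinctStart-∈ (length (m ++ (punchIn a j , a) ∷ x)) a j
      (subst₂ (λ l n → l ++ (punchIn a j , a) ∷ x ∈ openWords (punchIn a j , a) [] n)
        (trans (cong pairUp (reverse-involutive (map proj₂ m))) (sym (palindrome⇒pairUp pm)))
        (trans (cong (_+ suc (length x)) (trans (length-reverse (map proj₂ m)) (length-map proj₂ m)))
          (sym (length-++ m {(punchIn a j , a) ∷ x})))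
        (openWords-∈ _ (reverse (map proj₂ m)) [] x (starWords-∈ n x x≤ (_ , f))))
    cases : Dec (a ≡ b) → (a , b) ∷ m ++ (b , a) ∷ x ∈ starWords (suc (length (m ++ (b , a) ∷ x)))
    cases (yes refl) = equalStart-∈ (length (m ++ (a , a) ∷ x)) a (starWords-∈ n (m ++ (a , a) ∷ x) (ℕ.s≤s⁻¹ z≤)
      (star-++ (palindrome⇒star pm) (_ , _∷_ {q = []} refl f)))
    cases (no a≢b) = subst
      (λ b → (a , b) ∷ m ++ (b , a) ∷ x ∈ starWords (suc (length (m ++ (b , a) ∷ x))))
      (Fin.punchIn-punchOut a≢b) (distinct (punchOut a≢b))

  mutual
    #star : ℕ → ℕ
    #star zero    = 1
    #star (suc n) = k * #star n + k * (k′ * #open n)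

    -- Equals the sum of `k ^ m * #star (n ∸ 1 ∸ m)` over `m < n`, where `m` is the length of the
    -- inner part. Carrying it along makes a recursion over all earlier values first-order.
    #open : ℕ → ℕ
    #open zero    = 0
    #open (suc n) = #star n + k * #open n

  ∑-allFin-const : ∀ n c → ∑ (allFin n) (λ _ → c) ≡ n * c
  ∑-allFin-const n c = trans (∑-const (allFin n) c) (cong (_* c) (length-tabulate {n = n} (λ i → i)))

  mutual
    length-starWords : ∀ n → length (starWords n) ≡ #star n
    length-starWords zero    = refl
    length-starWords (suc n) = trans
      (length-++ (concatMap (equalStart n) (allFin k)))
      (cong₂ _+_ singles longer)
      where
      open ≡-Reasoning
      singles : length (concatMap (equalStart n) (allFin k)) ≡ k * #star n
      singles = begin
        length (concatMap (equalStart n) (allFin k))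
          ≡⟨ length-concatMap (equalStart n) (allFin k) ⟩
        ∑ (allFin k) (λ a → length (equalStart n a))
          ≡⟨ ∑-cong (allFin k) (λ a → trans (length-map _ (starWords n)) (length-starWords n)) ⟩
        ∑ (allFin k) (λ _ → #star n)
          ≡⟨ ∑-allFin-const k _ ⟩
        k * #star n ∎
      longer : length (concatMap (distinctStart n) (cartesianProduct (allFin k) (allFin k′))) ≡ k * (k′ * #open n)
      longer = begin
        _ ≡⟨ length-concatMap (distinctStart n) (cartesianProduct (allFin k) (allFin k′)) ⟩
        ∑ (cartesianProduct (allFin k) (allFin k′))
          (length ∘ distinctStart n)
          ≡⟨ ∑-cong (cartesianProduct (allFin k) (allFin k′)) (λ (a , j) →
               trans (length-map _ (openWords _ [] n)) (length-openWords _ [] n)) ⟩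
        ∑ (cartesianProduct (allFin k) (allFin k′)) (λ _ → #open n)
          ≡⟨ ∑-cartesianProductWith _,_ (allFin k) (allFin k′) _ ⟩
        ∑ (allFin k) (λ _ → ∑ (allFin k′) (λ _ → #open n))
          ≡⟨ trans (∑-allFin-const k _) (cong (k *_) (∑-allFin-const k′ _)) ⟩
        k * (k′ * #open n) ∎

    length-openWords : ∀ e u n → length (openWords e u n) ≡ #open n
    length-openWords e u zero    = refl
    length-openWords e u (suc n) = trans
      (length-++ (map (λ z → pairUp u ++ e ∷ z) (starWords n)))
      (cong₂ _+_
      (trans (length-map _ (starWords n)) (length-starWords n))
      (trans (length-concatMap (λ c → openWords e (c ∷ u) n) (allFin k))
        (trans (∑-cong (allFin k) λ c → length-openWords e (c ∷ u) n) (∑-allFin-const k _))))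

  -- Double counting: every concatenation occurs in the list and every entry matches at most one
  -- word. Repetitions in the list only enlarge the bound.
  starCount-≤-#star : ∀ n → starCount k n ≤ #star n
  starCount-≤-#star n = begin
    ∑ⁿ pairs n (𝟙 ∘ star? Fin._≟_)
      ≤⟨ ∑ⁿ-mono pairs n (λ { z refl → 𝟙-≤ (star? Fin._≟_ z) λ s → ℕ.≤-trans
           (ℕ.≤-reflexive (sym (𝟙-yes (≡-dec _≟_ z z) refl)))
           (∈⇒≤∑ (λ y → 𝟙 (≡-dec _≟_ z y)) (starWords-∈ _ z ℕ.≤-refl s)) }) ⟩
    ∑ⁿ pairs n (λ z → ∑ (starWords n) (λ y → 𝟙 (≡-dec _≟_ z y)))
      ≡⟨ ∑-∑ⁿ-swap pairs (starWords n) n _ ⟨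
    ∑ (starWords n) (λ y → ∑ⁿ pairs n (λ z → 𝟙 (≡-dec _≟_ z y)))
      ≤⟨ ∑-mono (starWords n) (∑ⁿ-≟-≤1 _≟_ (cartesianProduct⁺ (allFin⁺ k) (allFin⁺ k)) n) ⟩
    ∑ (starWords n) (λ _ → 1)
      ≡⟨ ∑-const (starWords n) 1 ⟩
    length (starWords n) * 1
      ≡⟨ trans (ℕ.*-identityʳ _) (length-starWords n) ⟩
    #star n ∎
    where
    open ℕ.≤-Reasoning
    pairs : List X
    pairs = cartesianProduct (allFin k) (allFin k)
    _≟_ : DecidableEquality X
    _≟_ = Product.≡-dec Fin._≟_ Fin._≟_

-- Exponential decay

module _ (j : ℕ) where

  private
    k K : ℕ
    k = suc (suc j)
    K = k * k

  -- The weights 3 and 2k make the linear recursion for (#star , #open) contract by 7/8 relative to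
  -- K, with equality in the second coordinate for k = 2.
  potential : ℕ → ℕ
  potential n = 3 * #star (suc j) n + 2 * k * #open (suc j) n

  potential-suc : ∀ n → 8 * potential (suc n) ≤ 7 * K * potential n
  -- The difference of the two sides is written out as a polynomial in `j`, that is `k - 2`, with
  -- nonnegative coefficients.
  potential-suc n = ℕ.m+n≤o⇒m≤o _ (ℕ.≤-reflexive (solve 3 (λ j s o →
    let k′ = con 1 :+ j ; k = con 2 :+ j in
    con 8 :* (con 3 :* (k :* s :+ k :* (k′ :* o)) :+ con 2 :* k :* (s :+ k :* o))
      :+ k :* ((con 21 :* j :+ con 2) :* s :+ (con 16 :* j :+ con 14 :* j :* j) :* o)
    := con 7 :* (k :* k) :* (con 3 :* s :+ con 2 :* k :* o))
    refl j (#star (suc j) n) (#open (suc j) n)))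
    where open +-*-Solver

  potential-≤ : ∀ n → 8 ^ n * potential n ≤ 3 * (7 ^ n * K ^ n)
  potential-≤ zero    = ℕ.≤-reflexive (cong (λ x → 3 + x + 0) (ℕ.*-zeroʳ (2 * k)))
  potential-≤ (suc n) = begin
    8 * 8 ^ n * potential (suc n)    ≡⟨ solve 2 (λ e v → con 8 :* e :* v := e :* (con 8 :* v)) refl (8 ^ n) (potential (suc n)) ⟩
    8 ^ n * (8 * potential (suc n))  ≤⟨ ℕ.*-monoʳ-≤ (8 ^ n) (potential-suc n) ⟩
    8 ^ n * (7 * K * potential n)    ≡⟨ solve 3 (λ e c v → e :* (c :* v) := c :* (e :* v)) refl (8 ^ n) (7 * K) (potential n) ⟩
    7 * K * (8 ^ n * potential n)    ≤⟨ ℕ.*-monoʳ-≤ (7 * K) (potential-≤ n) ⟩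
    7 * K * (3 * (7 ^ n * K ^ n))    ≡⟨ solve 3 (λ c p q → con 7 :* c :* (con 3 :* (p :* q)) := con 3 :* ((con 7 :* p) :* (c :* q))) refl K (7 ^ n) (K ^ n) ⟩
    3 * (7 ^ suc n * K ^ suc n)      ∎
    where
    open ℕ.≤-Reasoning
    open +-*-Solver

  -- The initial potential equals the weight 3 of `#star`, so both cancel and the bound has constant
  -- 1.
  starCount-≤ : ∀ n → 8 ^ n * starCount k n ≤ 7 ^ n * K ^ n
  starCount-≤ n = ℕ.*-cancelˡ-≤ 3 (begin
    3 * (8 ^ n * starCount k n)      ≤⟨ ℕ.*-monoʳ-≤ 3 (ℕ.*-monoʳ-≤ (8 ^ n) (starCount-≤-#star (suc j) n)) ⟩
    3 * (8 ^ n * #star (suc j) n)    ≡⟨ solve 2 (λ e s → con 3 :* (e :* s) := e :* (con 3 :* s)) refl (8 ^ n) _ ⟩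
    8 ^ n * (3 * #star (suc j) n)    ≤⟨ ℕ.*-monoʳ-≤ (8 ^ n) (ℕ.m≤m+n _ _) ⟩
    8 ^ n * potential n              ≤⟨ potential-≤ n ⟩
    3 * (7 ^ n * K ^ n)              ∎)
    where
    open ℕ.≤-Reasoning
    open +-*-Solver

-- Convergence

/-mono-≤ : ∀ a c b d .{{_ : NonZero c}} .{{_ : NonZero d}} → a * d ≤ b * c → pos a / c ℚ.≤ pos b / d
/-mono-≤ a c@(suc c-1) b d@(suc d-1) le = ℚ.toℚᵘ-cancel-≤ (begin
  ℚ.toℚᵘ (pos a / c)      ≃⟨ ℚ.toℚᵘ-fromℚᵘ (ℚᵘ.mkℚᵘ (pos a) c-1) ⟩
  ℚᵘ.mkℚᵘ (pos a) c-1     ≤⟨ ℚᵘ.*≤* (subst₂ ℤ._≤_ (ℤ.pos-* a d) (ℤ.pos-* b c) (ℤ.+≤+ le)) ⟩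
  ℚᵘ.mkℚᵘ (pos b) d-1     ≃⟨ ℚ.toℚᵘ-fromℚᵘ (ℚᵘ.mkℚᵘ (pos b) d-1) ⟨
  ℚ.toℚᵘ (pos b / d)      ∎)
  where open ℚᵘ.≤-Reasoning

/-≡ : ∀ a c b d .{{_ : NonZero c}} .{{_ : NonZero d}} → a * d ≡ b * c → pos a / c ≡ pos b / d
/-≡ a c b d eq = ℚ.≤-antisym (/-mono-≤ a c b d (ℕ.≤-reflexive eq)) (/-mono-≤ b d a c (ℕ.≤-reflexive (sym eq)))

/-distribʳ-+ : ∀ a b d .{{_ : NonZero d}} → pos (a + b) / d ≡ pos a / d ℚ.+ pos b / d
/-distribʳ-+ a b d@(suc d-1) = ℚ.toℚᵘ-injective (begin
  ℚ.toℚᵘ (pos (a + b) / d)                      ≈⟨ ℚ.toℚᵘ-fromℚᵘ (ℚᵘ.mkℚᵘ (pos (a + b)) d-1) ⟩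
  ℚᵘ.mkℚᵘ (pos (a + b)) d-1                     ≈⟨ ℚᵘ.*≡* eq ⟩
  ℚᵘ.mkℚᵘ (pos a) d-1 ℚᵘ.+ ℚᵘ.mkℚᵘ (pos b) d-1    ≈⟨ ℚᵘ.+-cong (ℚ.toℚᵘ-fromℚᵘ (ℚᵘ.mkℚᵘ (pos a) d-1)) (ℚ.toℚᵘ-fromℚᵘ (ℚᵘ.mkℚᵘ (pos b) d-1)) ⟨
  ℚ.toℚᵘ (pos a / d) ℚᵘ.+ ℚ.toℚᵘ (pos b / d)      ≈⟨ ℚ.toℚᵘ-homo-+ (pos a / d) (pos b / d) ⟨
  ℚ.toℚᵘ (pos a / d ℚ.+ pos b / d)                ∎)
  where
  open import Relation.Binary.Reasoning.Setoid ℚᵘ.≃-setoid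
  eq : pos (a + b) ℤ.* (pos d ℤ.* pos d) ≡ (pos a ℤ.* pos d ℤ.+ pos b ℤ.* pos d) ℤ.* pos d
  eq = trans (cong (ℤ._* (pos d ℤ.* pos d)) (ℤ.pos-+ a b))
    (trans (sym (ℤ.*-assoc (pos a ℤ.+ pos b) (pos d) (pos d)))
      (cong (ℤ._* pos d) (ℤ.*-distribʳ-+ (pos d) (pos a) (pos b))))

p≤q+r⇒p-q≤r : ∀ p q r → p ℚ.≤ q ℚ.+ r → p ℚ.- q ℚ.≤ r
p≤q+r⇒p-q≤r p q r p≤q+r = begin
  p ℚ.- q            ≤⟨ ℚ.+-monoˡ-≤ (ℚ.- q) p≤q+r ⟩
  (q ℚ.+ r) ℚ.- q    ≡⟨ solve 2 (λ q r → (q :+ r) :- q := r) refl q r ⟩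
  r                  ∎
  where
  open ℚ.≤-Reasoning
  open ℚSolver.+-*-Solver

∣p-q∣≤ : ∀ p q r → p ℚ.≤ q ℚ.+ r → q ℚ.≤ p ℚ.+ r → ℚ.∣ p ℚ.- q ∣ ℚ.≤ r
∣p-q∣≤ p q r p≤q+r q≤p+r with ℚ.∣p∣≡p∨∣p∣≡-p (p ℚ.- q)
... | inj₁ eq = subst (ℚ._≤ r) (sym eq) (p≤q+r⇒p-q≤r p q r p≤q+r)
... | inj₂ eq = subst (ℚ._≤ r) (sym (trans eq (neg-minus p q))) (p≤q+r⇒p-q≤r q p r q≤p+r)

∣p-q∣≡∣q-p∣ : ∀ p q → ℚ.∣ p ℚ.- q ∣ ≡ ℚ.∣ q ℚ.- p ∣
∣p-q∣≡∣q-p∣ p q = trans (sym (ℚ.∣-p∣≡∣p∣ (p ℚ.- q))) (cong ℚ.∣_∣ (neg-minus p q))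

p≤p+q : ∀ p {q} → 0ℚ ℚ.≤ q → p ℚ.≤ p ℚ.+ q
p≤p+q p {q} 0≤q = subst (ℚ._≤ p ℚ.+ q) (ℚ.+-identityʳ p) (ℚ.+-monoʳ-≤ p 0≤q)

0≤/ : ∀ a d .{{_ : NonZero d}} → 0ℚ ℚ.≤ pos a / d
0≤/ a d = ℚ.nonNegative⁻¹ (pos a / d) {{ℚ.normalize-nonNeg a d}}

-- A positive `ε` has numerator at least 1, hence is at least `1 / ↧ₙ ε`.
archimedean : ∀ C ε → 0ℚ ℚ.< ε → ∀ n → C * ↧ₙ ε ≤ n → pos C / suc n ℚ.≤ ε
archimedean C ε 0<ε n N≤n = subst (pos C / suc n ℚ.≤_) (ℚ.↥p/↧p≡p ε) (bound ε (ℚ.positive 0<ε) N≤n)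
  where
  bound : ∀ ε → ℚ.Positive ε → C * ↧ₙ ε ≤ n → pos C / suc n ℚ.≤ ℚ.↥ ε / ↧ₙ ε
  bound (mkℚ (pos (suc p)) d-1 _) _ N≤n = /-mono-≤ C (suc n) (suc p) (suc d-1)
    (ℕ.≤-trans N≤n (ℕ.≤-trans (ℕ.n≤1+n n) (ℕ.m≤m+n (suc n) (p * suc n))))

cauchy⇒hasLimit : ∀ (x : ℕ → ℚ) C →
  (∀ {m n} → m ≤ n → ℚ.∣ x m ℚ.- x n ∣ ℚ.≤ pos C / suc m) → HasLimit (fromℚ ∘ x)
cauchy⇒hasLimit x C cauchy = mkℝ (x ∘ index) regular , converges
  where
  -- Sampling at `C * suc n` turns the error `C / suc m` into at most `1/1+ n`, as regularity
  -- demands.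
  index : ℕ → ℕ
  index n = C * suc n

  index-error : ∀ n → pos C / suc (index n) ℚ.≤ 1/1+ n
  index-error n = /-mono-≤ C (suc (index n)) 1 (suc n)
    (ℕ.≤-trans (ℕ.n≤1+n (index n)) (ℕ.≤-reflexive (sym (ℕ.*-identityˡ _))))

  regular : ∀ m n → ℚ.∣ x (index m) ℚ.- x (index n) ∣ ℚ.≤ 1/1+ m ℚ.+ 1/1+ n
  regular m n with ℕ.≤-total m n
  ... | inj₁ m≤n = ℚ.≤-trans (cauchy (ℕ.*-monoʳ-≤ C (s≤s m≤n)))
          (ℚ.≤-trans (index-error m) (p≤p+q (1/1+ m) (0≤1/1+ n)))
  ... | inj₂ n≤m = subst₂ ℚ._≤_ (∣p-q∣≡∣q-p∣ (x (index n)) (x (index m))) (ℚ.+-comm (1/1+ n) (1/1+ m))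
          (ℚ.≤-trans (cauchy (ℕ.*-monoʳ-≤ C (s≤s n≤m)))
            (ℚ.≤-trans (index-error n) (p≤p+q (1/1+ n) (0≤1/1+ m))))

  -- Convergence with the real operations unfolded; `double j` is the index at which subtraction
  -- reads its arguments.
  converges : ∀ ε → 0ℚ ℚ.< ε → ∃ λ N → ∀ n → N ≤ n → ∀ j →
    ℚ.∣ x n ℚ.- x (index (double j)) ∣ ℚ.≤ ε ℚ.+ (1/1+ j ℚ.+ 1/1+ j)
  converges ε 0<ε = C * ↧ₙ ε , bound
    where
    bound : ∀ n → C * ↧ₙ ε ≤ n → ∀ j →
      ℚ.∣ x n ℚ.- x (index (double j)) ∣ ℚ.≤ ε ℚ.+ (1/1+ j ℚ.+ 1/1+ j)
    bound n N≤n j with ℕ.≤-total n (index (double j))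
    ... | inj₁ n≤ = ℚ.≤-trans (cauchy n≤) (ℚ.≤-trans (archimedean C ε 0<ε n N≤n)
            (p≤p+q ε (ℚ.+-mono-≤ (0≤1/1+ j) (0≤1/1+ j))))
    -- Here the sampled term comes first, so the slack in `j` absorbs the error instead of `ε`.
    ... | inj₂ ≤n = begin
      ℚ.∣ x n ℚ.- x (index (double j)) ∣  ≡⟨ ∣p-q∣≡∣q-p∣ (x n) (x (index (double j))) ⟩
      ℚ.∣ x (index (double j)) ℚ.- x n ∣  ≤⟨ cauchy ≤n ⟩
      pos C / suc (index (double j))        ≤⟨ index-error (double j) ⟩
      1/1+ (double j)                     ≤⟨ /-mono-≤ 1 (suc (double j)) 1 (suc j) (ℕ.*-monoʳ-≤ 1 (s≤s (ℕ.m≤m+n j (suc j)))) ⟩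
      1/1+ j                              ≤⟨ p≤p+q (1/1+ j) (0≤1/1+ j) ⟩
      1/1+ j ℚ.+ 1/1+ j                   ≡⟨ ℚ.+-identityˡ _ ⟨
      0ℚ ℚ.+ (1/1+ j ℚ.+ 1/1+ j)          ≤⟨ ℚ.+-monoˡ-≤ (1/1+ j ℚ.+ 1/1+ j) (ℚ.<⇒≤ 0<ε) ⟩
      ε ℚ.+ (1/1+ j ℚ.+ 1/1+ j)           ∎
      where open ℚ.≤-Reasoning

-- Cauchy estimate for the expected width

opaque
  fraction : (a b n : ℕ) .{{_ : NonZero b}} → ℚ
  fraction a b n = _/_ (pos a) (b ^ n) {{ℕ.m^n≢0 b n}}

  0≤fraction : ∀ a b n .{{_ : NonZero b}} → 0ℚ ℚ.≤ fraction a b n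
  0≤fraction a b n = 0≤/ a (b ^ n) {{ℕ.m^n≢0 b n}}

  fraction-mono-≤ : ∀ a b n a′ b′ n′ .{{_ : NonZero b}} .{{_ : NonZero b′}} →
    a * b′ ^ n′ ≤ a′ * b ^ n → fraction a b n ℚ.≤ fraction a′ b′ n′
  fraction-mono-≤ a b n a′ b′ n′ =
    /-mono-≤ a (b ^ n) a′ (b′ ^ n′) {{ℕ.m^n≢0 b n}} {{ℕ.m^n≢0 b′ n′}}

  fraction-≡ : ∀ a b n a′ b′ n′ .{{_ : NonZero b}} .{{_ : NonZero b′}} →
    a * b′ ^ n′ ≡ a′ * b ^ n → fraction a b n ≡ fraction a′ b′ n′
  fraction-≡ a b n a′ b′ n′ =
    /-≡ a (b ^ n) a′ (b′ ^ n′) {{ℕ.m^n≢0 b n}} {{ℕ.m^n≢0 b′ n′}}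

  fraction-+ : ∀ a a′ b n .{{_ : NonZero b}} → fraction (a + a′) b n ≡ fraction a b n ℚ.+ fraction a′ b n
  fraction-+ a a′ b n = /-distribʳ-+ a a′ (b ^ n) {{ℕ.m^n≢0 b n}}

  fraction-mono-/ : ∀ a b n c d .{{_ : NonZero b}} .{{_ : NonZero d}} →
    a * d ≤ c * b ^ n → fraction a b n ℚ.≤ pos c / d
  fraction-mono-/ a b n c d = /-mono-≤ a (b ^ n) c d {{ℕ.m^n≢0 b n}}

  1≡fraction : 1ℚ ≡ fraction 1 1 0
  1≡fraction = refl

  E≡fraction : ∀ k n .{{_ : NonZero k}} → E k n ≡ fraction (totalWidth k n) k n
  E≡fraction k n = refl

module _ (j : ℕ) where

  private
    k K : ℕ
    k = suc (suc j)
    K = k * k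

  starDensity : ℕ → ℚ
  starDensity h = fraction (starCount k h) K h

  meanStarSuffixes : ℕ → ℚ
  meanStarSuffixes h = fraction (starSuffixCount k h) K h

  -- Seven times (7/8) ^ h, the sum of the geometric series from h + 1 on.
  tail : ℕ → ℚ
  tail h = fraction (7 * 7 ^ h) 8 h

  oddMean : ℕ → ℚ
  oddMean h = (meanStarSuffixes h ℚ.+ meanStarSuffixes h) ℚ.+ 1ℚ

  0≤tail : ∀ h → 0ℚ ℚ.≤ tail h
  0≤tail h = 0≤fraction (7 * 7 ^ h) 8 h

  0≤starDensity : ∀ h → 0ℚ ℚ.≤ starDensity h
  0≤starDensity h = 0≤fraction (starCount k h) K h

  starDensity≤ : ∀ h → starDensity h ℚ.≤ fraction (7 ^ h) 8 h
  starDensity≤ h = fraction-mono-≤ (starCount k h) K h (7 ^ h) 8 h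
    (ℕ.≤-trans (ℕ.≤-reflexive (ℕ.*-comm (starCount k h) (8 ^ h))) (starCount-≤ j h))

  starDensity≤tail : ∀ h → starDensity h ℚ.≤ tail h
  starDensity≤tail h = ℚ.≤-trans (starDensity≤ h)
    (fraction-mono-≤ (7 ^ h) 8 h (7 * 7 ^ h) 8 h (ℕ.*-monoˡ-≤ (8 ^ h) (ℕ.m≤m+n (7 ^ h) _)))

  tail-suc : ∀ h → fraction (7 ^ suc h) 8 (suc h) ℚ.+ tail (suc h) ≡ tail h
  tail-suc h = trans (sym (fraction-+ (7 ^ suc h) (7 * 7 ^ suc h) 8 (suc h)))
    (fraction-≡ (7 ^ suc h + 7 * 7 ^ suc h) 8 (suc h) (7 * 7 ^ h) 8 h
      (solve 2 (λ s e → (con 7 :* s :+ con 7 :* (con 7 :* s)) :* e := con 7 :* s :* (con 8 :* e))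
        refl (7 ^ h) (8 ^ h)))
    where open +-*-Solver

  meanStarSuffixes-suc : ∀ h → meanStarSuffixes (suc h) ≡ meanStarSuffixes h ℚ.+ starDensity (suc h)
  meanStarSuffixes-suc h = begin
    fraction (starSuffixCount k (suc h)) K (suc h)
      ≡⟨ cong (λ x → fraction x K (suc h)) (trans (starSuffixCount-suc k h) (ℕ.+-comm (starCount k (suc h)) _)) ⟩
    fraction (K * starSuffixCount k h + starCount k (suc h)) K (suc h)
      ≡⟨ fraction-+ (K * starSuffixCount k h) (starCount k (suc h)) K (suc h) ⟩
    fraction (K * starSuffixCount k h) K (suc h) ℚ.+ starDensity (suc h)
      ≡⟨ cong (ℚ._+ starDensity (suc h)) (fraction-≡ (K * starSuffixCount k h) K (suc h) (starSuffixCount k h) K h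
           (solve 3 (λ c t p → c :* t :* p := t :* (c :* p)) refl K (starSuffixCount k h) (K ^ h))) ⟩
    meanStarSuffixes h ℚ.+ starDensity (suc h) ∎
    where
    open ≡-Reasoning
    open +-*-Solver

  meanStarSuffixes-mono : ∀ {h h′} → h ℕ.≤′ h′ → meanStarSuffixes h ℚ.≤ meanStarSuffixes h′
  meanStarSuffixes-mono (ℕ.≤′-reflexive refl) = ℚ.≤-refl
  meanStarSuffixes-mono {h} {suc h′} (ℕ.≤′-step h≤h′) = begin
    meanStarSuffixes h                              ≤⟨ meanStarSuffixes-mono h≤h′ ⟩
    meanStarSuffixes h′                             ≤⟨ p≤p+q _ (0≤starDensity (suc h′)) ⟩
    meanStarSuffixes h′ ℚ.+ starDensity (suc h′)    ≡⟨ meanStarSuffixes-suc h′ ⟨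
    meanStarSuffixes (suc h′)                       ∎
    where open ℚ.≤-Reasoning

  tail-antimono : ∀ {h h′} → h ℕ.≤′ h′ → tail h′ ℚ.≤ tail h
  tail-antimono (ℕ.≤′-reflexive refl) = ℚ.≤-refl
  tail-antimono {h} {suc h′} (ℕ.≤′-step h≤h′) = begin
    tail (suc h′)                                ≤⟨ p≤p+q _ (0≤fraction (7 ^ suc h′) 8 (suc h′)) ⟩
    tail (suc h′) ℚ.+ fraction (7 ^ suc h′) 8 (suc h′)  ≡⟨ ℚ.+-comm (tail (suc h′)) _ ⟩
    fraction (7 ^ suc h′) 8 (suc h′) ℚ.+ tail (suc h′)  ≡⟨ tail-suc h′ ⟩
    tail h′                                      ≤⟨ tail-antimono h≤h′ ⟩
    tail h                                       ∎
    where open ℚ.≤-Reasoning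

  -- In each step the mean grows by at most the power of 7/8 by which `tail` shrinks. This bounds
  -- all later growth without an infinite sum.
  meanStarSuffixes+tail-antimono : ∀ {h h′} → h ℕ.≤′ h′ →
    meanStarSuffixes h′ ℚ.+ tail h′ ℚ.≤ meanStarSuffixes h ℚ.+ tail h
  meanStarSuffixes+tail-antimono (ℕ.≤′-reflexive refl) = ℚ.≤-refl
  meanStarSuffixes+tail-antimono {h} {suc h′} (ℕ.≤′-step h≤h′) = begin
    meanStarSuffixes (suc h′) ℚ.+ tail (suc h′)
      ≡⟨ trans (cong (ℚ._+ tail (suc h′)) (meanStarSuffixes-suc h′)) (ℚ.+-assoc (meanStarSuffixes h′) _ _) ⟩
    meanStarSuffixes h′ ℚ.+ (starDensity (suc h′) ℚ.+ tail (suc h′))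
      ≤⟨ ℚ.+-monoʳ-≤ (meanStarSuffixes h′) (ℚ.+-monoˡ-≤ (tail (suc h′)) (starDensity≤ (suc h′))) ⟩
    meanStarSuffixes h′ ℚ.+ (fraction (7 ^ suc h′) 8 (suc h′) ℚ.+ tail (suc h′))
      ≡⟨ cong (meanStarSuffixes h′ ℚ.+_) (tail-suc h′) ⟩
    meanStarSuffixes h′ ℚ.+ tail h′
      ≤⟨ meanStarSuffixes+tail-antimono h≤h′ ⟩
    meanStarSuffixes h ℚ.+ tail h ∎
    where open ℚ.≤-Reasoning

  oddMean≡ : ∀ h → oddMean h ≡ fraction (2 * starSuffixCount k h + K ^ h) K h
  oddMean≡ h = sym (begin
    fraction (2 * T + K ^ h) K h
      ≡⟨ cong (λ x → fraction (x + K ^ h) K h) (cong (ℕ._+_ T) (ℕ.+-identityʳ T)) ⟩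
    fraction (T + T + K ^ h) K h
      ≡⟨ fraction-+ (T + T) (K ^ h) K h ⟩
    fraction (T + T) K h ℚ.+ fraction (K ^ h) K h
      ≡⟨ cong₂ ℚ._+_ (fraction-+ T T K h) (trans (fraction-≡ (K ^ h) K h 1 1 0 (ℕ.*-comm (K ^ h) 1)) (sym 1≡fraction)) ⟩
    oddMean h ∎)
    where
    open ≡-Reasoning
    T : ℕ
    T = starSuffixCount k h

  ^-double : ∀ h r → k ^ (h + (h + r)) ≡ K ^ h * k ^ r
  ^-double h r = begin
    k ^ (h + (h + r))        ≡⟨ trans (ℕ.^-distribˡ-+-* k h (h + r)) (cong (k ^ h *_) (ℕ.^-distribˡ-+-* k h r)) ⟩
    k ^ h * (k ^ h * k ^ r)  ≡⟨ ℕ.*-assoc (k ^ h) _ _ ⟨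
    k ^ h * k ^ h * k ^ r    ≡⟨ cong (_* k ^ r) (square h) ⟩
    K ^ h * k ^ r            ∎
    where
    open ≡-Reasoning
    open +-*-Solver
    square : ∀ h → k ^ h * k ^ h ≡ K ^ h
    square zero    = refl
    square (suc h) = trans (solve 2 (λ k p → k :* p :* (k :* p) := k :* k :* (p :* p)) refl k (k ^ h))
      (cong (K *_) (square h))

  E-odd : ∀ n h → n ≡ h + (h + 1) → E k n ≡ oddMean h
  E-odd n h refl = begin
    E k n
      ≡⟨ E≡fraction k n ⟩
    fraction (totalWidth k n) k n
      ≡⟨ fraction-≡ (totalWidth k n) k n S K h scale ⟩
    fraction S K h
      ≡⟨ oddMean≡ h ⟨
    oddMean h ∎
    where
    open ≡-Reasoning
    open +-*-Solver
    S : ℕ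
    S = 2 * starSuffixCount k h + K ^ h
    scale : totalWidth k n * K ^ h ≡ S * k ^ n
    scale = begin
      totalWidth k n * K ^ h  ≡⟨ cong (_* K ^ h) (totalWidth-odd k h) ⟩
      k * S * K ^ h           ≡⟨ solve 3 (λ k s p → k :* s :* p := s :* (p :* (k :* con 1))) refl k S (K ^ h) ⟩
      S * (K ^ h * k ^ 1)     ≡⟨ cong (S *_) (^-double h 1) ⟨
      S * k ^ n               ∎

  E-even : ∀ n h → n ≡ h + (h + 0) → E k n ℚ.+ starDensity h ≡ oddMean h
  E-even n h refl = begin
    E k n ℚ.+ starDensity h
      ≡⟨ cong (ℚ._+ starDensity h) (trans (E≡fraction k n) (fraction-≡ (totalWidth k n) k n (totalWidth k n) K h
           (cong (totalWidth k n *_) (sym (trans (^-double h 0) (ℕ.*-identityʳ (K ^ h))))))) ⟩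
    fraction (totalWidth k n) K h ℚ.+ starDensity h
      ≡⟨ fraction-+ (totalWidth k n) (starCount k h) K h ⟨
    fraction (totalWidth k n + starCount k h) K h
      ≡⟨ cong (λ x → fraction x K h) (totalWidth-even k h) ⟩
    fraction (2 * starSuffixCount k h + K ^ h) K h
      ≡⟨ oddMean≡ h ⟨
    oddMean h ∎
    where open ≡-Reasoning

  halve : ∀ n → (n ≡ ⌊ n /2⌋ + (⌊ n /2⌋ + 0)) ⊎ (n ≡ ⌊ n /2⌋ + (⌊ n /2⌋ + 1))
  halve zero          = inj₁ refl
  halve (suc zero)    = inj₂ refl
  halve (suc (suc n)) with halve n
  ... | inj₁ eq = inj₁ (cong suc (trans (cong suc eq) (sym (ℕ.+-suc ⌊ n /2⌋ _))))
  ... | inj₂ eq = inj₂ (cong suc (trans (cong suc eq) (sym (ℕ.+-suc ⌊ n /2⌋ _))))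

  -- With `oddMean≤E+tail` this keeps `E` within one tail below a monotone sequence for both
  -- parities, so the Cauchy estimate needs no parity cases.
  E≤oddMean : ∀ n → E k n ℚ.≤ oddMean ⌊ n /2⌋
  E≤oddMean n =
    [ (λ eq → subst (E k n ℚ.≤_) (E-even n ⌊ n /2⌋ eq) (p≤p+q (E k n) (0≤starDensity ⌊ n /2⌋)))
    , (λ eq → ℚ.≤-reflexive (E-odd n ⌊ n /2⌋ eq))
    ]′ (halve n)

  oddMean≤E+tail : ∀ n → oddMean ⌊ n /2⌋ ℚ.≤ E k n ℚ.+ tail ⌊ n /2⌋
  oddMean≤E+tail n =
    [ (λ eq → subst (ℚ._≤ E k n ℚ.+ tail ⌊ n /2⌋) (E-even n ⌊ n /2⌋ eq)
                (ℚ.+-monoʳ-≤ (E k n) (starDensity≤tail ⌊ n /2⌋)))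
    , (λ eq → subst (ℚ._≤ E k n ℚ.+ tail ⌊ n /2⌋) (E-odd n ⌊ n /2⌋ eq)
                (p≤p+q (E k n) (0≤tail ⌊ n /2⌋)))
    ]′ (halve n)

  -- Bernoulli's inequality (8/7)^h ≥ 1 + h/7, cleared of denominators. It trades geometric decay
  -- for the rate 1/n that `cauchy⇒hasLimit` expects.
  bernoulli : ∀ h → 7 ^ h * (7 + h) ≤ 7 * 8 ^ h
  bernoulli zero    = ℕ.≤-refl
  bernoulli (suc h) = begin
    7 * 7 ^ h * (7 + suc h)      ≡⟨ solve 2 (λ p h → con 7 :* p :* (con 8 :+ h) := p :* (con 56 :+ con 7 :* h)) refl (7 ^ h) h ⟩
    7 ^ h * (56 + 7 * h)         ≤⟨ ℕ.*-monoʳ-≤ (7 ^ h) (ℕ.+-monoʳ-≤ 56 (ℕ.m≤n+m (7 * h) h)) ⟩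
    7 ^ h * (56 + 8 * h)         ≡⟨ solve 2 (λ p h → p :* (con 56 :+ con 8 :* h) := con 8 :* (p :* (con 7 :+ h))) refl (7 ^ h) h ⟩
    8 * (7 ^ h * (7 + h))        ≤⟨ ℕ.*-monoʳ-≤ 8 (bernoulli h) ⟩
    8 * (7 * 8 ^ h)              ≡⟨ solve 1 (λ e → con 8 :* (con 7 :* e) := con 7 :* (con 8 :* e)) refl (8 ^ h) ⟩
    7 * 8 ^ suc h                ∎
    where
    open ℕ.≤-Reasoning
    open +-*-Solver

  -- 294 is 3 · 7 · 2 · 7: three tails, the factor 7 in `tail`, the halving of `n`, and the 7 in
  -- `bernoulli`.
  tail-bound : ∀ n → (tail ⌊ n /2⌋ ℚ.+ tail ⌊ n /2⌋) ℚ.+ tail ⌊ n /2⌋ ℚ.≤ pos 294 / suc n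
  tail-bound n = begin
    (tail h ℚ.+ tail h) ℚ.+ tail h
      ≡⟨ trans (fraction-+ (s + s) s 8 h) (cong (ℚ._+ tail h) (fraction-+ s s 8 h)) ⟨
    fraction (s + s + s) 8 h
      ≤⟨ fraction-mono-/ (s + s + s) 8 h 294 (suc n) le ⟩
    pos 294 / suc n ∎
    where
    open ℚ.≤-Reasoning
    h s : ℕ
    h = ⌊ n /2⌋
    s = 7 * 7 ^ h
    -- Generous by 12, to match the factor `7 + h` of `bernoulli`.
    n≤ : suc n ≤ 2 * (7 + h)
    n≤ = ℕ.≤-trans (s≤s (length-halves (halve n))) (ℕ.≤-trans (ℕ.m≤m+n _ 12)
           (ℕ.≤-reflexive (solve 1 (λ h → con 1 :+ (h :+ (h :+ con 1)) :+ con 12 := con 2 :* (con 7 :+ h)) refl h)))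
      where
      open +-*-Solver
      length-halves : (n ≡ h + (h + 0)) ⊎ (n ≡ h + (h + 1)) → n ≤ h + (h + 1)
      length-halves (inj₁ eq) = ℕ.≤-trans (ℕ.≤-reflexive eq) (ℕ.+-monoʳ-≤ h (ℕ.+-monoʳ-≤ h z≤n))
      length-halves (inj₂ eq) = ℕ.≤-reflexive eq
    le : (s + s + s) * suc n ≤ 294 * 8 ^ h
    le = ℕ.≤-trans (ℕ.*-monoʳ-≤ (s + s + s) n≤) (ℕ.≤-trans
      (ℕ.≤-reflexive (solve 2 (λ p h → let s = con 7 :* p in
        (s :+ s :+ s) :* (con 2 :* (con 7 :+ h)) := con 42 :* (p :* (con 7 :+ h))) refl (7 ^ h) h))
      (ℕ.≤-trans (ℕ.*-monoʳ-≤ 42 (bernoulli h)) (ℕ.≤-reflexive (sym (ℕ.*-assoc 42 7 (8 ^ h))))))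
      where open +-*-Solver

  -- Of the three tails, two bound the growth of the doubled mean and one the gap between `E` and
  -- `oddMean` at `m`.
  E-cauchy : ∀ {m n} → m ≤ n → ℚ.∣ E k m ℚ.- E k n ∣ ℚ.≤ pos 294 / suc m
  E-cauchy {m} {n} m≤n = ℚ.≤-trans (∣p-q∣≤ (E k m) (E k n) _ upper lower) (tail-bound m)
    where
    open ℚ.≤-Reasoning
    open ℚSolver.+-*-Solver
    g h : ℕ
    g = ⌊ m /2⌋
    h = ⌊ n /2⌋
    g≤h : g ℕ.≤′ h
    g≤h = ℕ.≤⇒≤′ (ℕ.⌊n/2⌋-mono m≤n)
    upper : E k m ℚ.≤ E k n ℚ.+ ((tail g ℚ.+ tail g) ℚ.+ tail g)
    upper = begin
      E k m
        ≤⟨ E≤oddMean m ⟩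
      oddMean g
        ≤⟨ ℚ.+-monoˡ-≤ 1ℚ (ℚ.+-mono-≤ (meanStarSuffixes-mono g≤h) (meanStarSuffixes-mono g≤h)) ⟩
      oddMean h
        ≤⟨ oddMean≤E+tail n ⟩
      E k n ℚ.+ tail h
        ≤⟨ ℚ.+-monoʳ-≤ (E k n) (tail-antimono g≤h) ⟩
      E k n ℚ.+ tail g
        ≤⟨ ℚ.+-monoʳ-≤ (E k n) (ℚ.≤-trans (p≤p+q (tail g) (0≤tail g)) (p≤p+q (tail g ℚ.+ tail g) (0≤tail g))) ⟩
      E k n ℚ.+ ((tail g ℚ.+ tail g) ℚ.+ tail g) ∎
    rise : meanStarSuffixes h ℚ.≤ meanStarSuffixes g ℚ.+ tail g
    rise = ℚ.≤-trans (p≤p+q _ (0≤tail h)) (meanStarSuffixes+tail-antimono g≤h)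
    lower : E k n ℚ.≤ E k m ℚ.+ ((tail g ℚ.+ tail g) ℚ.+ tail g)
    lower = begin
      E k n
        ≤⟨ E≤oddMean n ⟩
      oddMean h
        ≤⟨ ℚ.+-monoˡ-≤ 1ℚ (ℚ.+-mono-≤ rise rise) ⟩
      ((meanStarSuffixes g ℚ.+ tail g) ℚ.+ (meanStarSuffixes g ℚ.+ tail g)) ℚ.+ 1ℚ
        ≡⟨ solve 3 (λ t r o → ((t :+ r) :+ (t :+ r)) :+ o := ((t :+ t) :+ o) :+ (r :+ r)) refl (meanStarSuffixes g) (tail g) 1ℚ ⟩
      oddMean g ℚ.+ (tail g ℚ.+ tail g)
        ≤⟨ ℚ.+-monoˡ-≤ (tail g ℚ.+ tail g) (oddMean≤E+tail m) ⟩
      (E k m ℚ.+ tail g) ℚ.+ (tail g ℚ.+ tail g)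
        ≡⟨ solve 2 (λ e r → (e :+ r) :+ (r :+ r) := e :+ ((r :+ r) :+ r)) refl (E k m) (tail g) ⟩
      E k m ℚ.+ ((tail g ℚ.+ tail g) ℚ.+ tail g) ∎

theorem4 : (k : ℕ) (2≤k : 2 ℕ.≤ k) →
    HasLimit (λ n → fromℚ (E k {{>-nonZero (<-trans z<s 2≤k)}} n))
theorem4 (suc (suc j)) (s≤s (s≤s z≤n)) = cauchy⇒hasLimit (E (suc (suc j))) 294 (E-cauchy j)
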